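{- Let $G$ be a graph of order $n$ and maximum degree $\Delta(G)=1$. Then $\mathcal{A}(G)\le \mathcal{A}\big(\lfloor n/2\rfloor K_2\cup (n \bmod 2)K_1\big)$, with equality if and only if $G$ is isomorphic to $\lfloor n/2\rfloor K_2\cup (n\bmod 2)K_1$.
   Context: Graphs are finite and simple. For a graph $G$ of order $n$ and an integer $k$, $S(G,k)$ denotes the number of partitions of $V(G)$ into exactly $k$ nonempty stable sets (non-equivalent colorings with exactly $k$ colors). Let $\mathcal{B}(G)=\sum_{k=1}^n S(G,k)$, $\mathcal{T}(G)=\sum_{k=1}^n kS(G,k)$, and $\mathcal{A}(G)=\mathcal{T}(G)/\mathcal{B}(G)$. $G\cup H$ denotes disjoint union, $pH$ the disjoint union of $p$ copies of $H$ ($0H$ is the empty graph on no vertices), and $K_m$ the complete graph on $m$ vertices. -}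

module Defs where

open import Data.Nat using (ℕ; zero; suc; _+_; _*_; _≤_; _/_; _≡ᵇ_)
open import Data.Nat.Properties using (_≟_; _<?_)
open import Data.Empty using (⊥-elim)
open import Data.Bool using (Bool; true; false; _∧_; _∨_; not)
open import Data.Fin using (Fin; toℕ)
open import Data.Fin.Properties using () renaming (_≟_ to _≟ᶠ_)
open import Data.Fin.Permutation using (Permutation′; _⟨$⟩ʳ_)
open import Data.Vec using (Vec; []; _∷_; lookup)
open import Data.List using (List; []; _∷_; map; concatMap; length; filterᵇ; allFin; upTo)
open import Data.Bool.ListAction using (all; any)
open import Data.Nat.ListAction using (sum)
open import Data.Product using (Σ; _×_)
open import Relation.Binary.PropositionalEquality using (_≡_; refl) renaming (sym to ≡-sym)
open import Relation.Nullary.Decidable using (⌊_⌋; yes; no)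

record Graph (n : ℕ) : Set where
  field
    adj    : Fin n → Fin n → Bool
    sym    : ∀ i j → adj i j ≡ adj j i
    irrefl : ∀ i → adj i i ≡ false
open Graph public

count : {A : Set} → (A → Bool) → List A → ℕ
count p xs = length (filterᵇ p xs)

deg : {n : ℕ} → Graph n → Fin n → ℕ
deg {n} G v = count (adj G v) (allFin n)

MaxDegreeOne : {n : ℕ} → Graph n → Set
MaxDegreeOne {n} G = (∀ v → deg G v ≤ 1) × Σ (Fin n) (λ v → deg G v ≡ 1)

Isomorphic : {n : ℕ} → Graph n → Graph n → Set
Isomorphic {n} G H =
  Σ (Permutation′ n) λ π → ∀ i j → adj G i j ≡ adj H (π ⟨$⟩ʳ i) (π ⟨$⟩ʳ j)

-- The graph ⌊n/2⌋K₂ ∪ (n mod 2)K₁ on Fin n: vertices 2i and 2i+1 are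
-- adjacent (for 2i+1 < n); if n is odd, vertex n-1 is isolated.
matchAdj : {n : ℕ} → Fin n → Fin n → Bool
matchAdj i j = ⌊ toℕ i / 2 ≟ toℕ j / 2 ⌋ ∧ not ⌊ i ≟ᶠ j ⌋

matchSym : {n : ℕ} (i j : Fin n) → matchAdj i j ≡ matchAdj j i
matchSym i j with toℕ i / 2 ≟ toℕ j / 2 | toℕ j / 2 ≟ toℕ i / 2 | i ≟ᶠ j | j ≟ᶠ i
... | yes _ | yes _ | yes _ | yes _ = refl
... | yes _ | yes _ | no _  | no _  = refl
... | yes _ | yes _ | yes p | no q  = ⊥-elim (q (≡-sym p))
... | yes _ | yes _ | no q  | yes p = ⊥-elim (q (≡-sym p))
... | no _  | no _  | _     | _     = refl
... | yes p | no q  | _     | _     = ⊥-elim (q (≡-sym p))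
... | no q  | yes p | _     | _     = ⊥-elim (q (≡-sym p))

matchIrrefl : {n : ℕ} (i : Fin n) → matchAdj i i ≡ false
matchIrrefl i with toℕ i / 2 ≟ toℕ i / 2 | i ≟ᶠ i
... | _     | no q  = ⊥-elim (q refl)
... | yes _ | yes _ = refl
... | no _  | yes _ = refl

matchingGraph : (n : ℕ) → Graph n
matchingGraph n = record { adj = matchAdj ; sym = matchSym ; irrefl = matchIrrefl }

allVecs : (m n : ℕ) → List (Vec (Fin m) n)
allVecs m zero    = [] ∷ []
allVecs m (suc n) = concatMap (λ x → map (x ∷_) (allVecs m n)) (allFin m)

-- Partitions of V(G) = Fin n are encoded canonically as colorings
-- c : Fin n → Fin n in which colors are numbered by order of first
-- appearance (restricted growth strings): a vertex i with color v > 0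
-- has an earlier vertex j < i with color v - 1. The blocks are the
-- nonempty color classes.
Canonical : {n : ℕ} → (Fin n → Fin n) → Bool
Canonical {n} c = all (λ i → (toℕ (c i) ≡ᵇ 0) ∨
  any (λ j → ⌊ toℕ j <? toℕ i ⌋ ∧ (suc (toℕ (c j)) ≡ᵇ toℕ (c i))) (allFin n)) (allFin n)

Proper : {n : ℕ} → Graph n → (Fin n → Fin n) → Bool
Proper {n} G c = all (λ i → all (λ j → not (adj G i j) ∨ not ⌊ c i ≟ᶠ c j ⌋) (allFin n)) (allFin n)

numBlocks : {n : ℕ} → (Fin n → Fin n) → ℕ
numBlocks {n} c = count (λ v → any (λ i → ⌊ c i ≟ᶠ v ⌋) (allFin n)) (allFin n)

S : {n : ℕ} → Graph n → ℕ → ℕ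
S {n} G k = count (λ c → Proper G c ∧ Canonical c ∧ (numBlocks c ≡ᵇ k))
                  (map lookup (allVecs n n))

oneTo : ℕ → List ℕ
oneTo n = map suc (upTo n)

𝓑 : {n : ℕ} → Graph n → ℕ
𝓑 {n} G = sum (map (S G) (oneTo n))

𝓣 : {n : ℕ} → Graph n → ℕ
𝓣 {n} G = sum (map (λ k → k * S G k) (oneTo n))

-- 𝓐(G) ≤ 𝓐(H)  and  𝓐(G) = 𝓐(H), with 𝓐 = 𝓣/𝓑, by cross-multiplication
-- (𝓑 > 0 for n ≥ 1).
_𝓐≤_ : {n m : ℕ} → Graph n → Graph m → Set
G 𝓐≤ H = 𝓣 G * 𝓑 H ≤ 𝓣 H * 𝓑 G

_𝓐≡_ : {n m : ℕ} → Graph n → Graph m → Set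
G 𝓐≡ H = 𝓣 G * 𝓑 H ≡ 𝓣 H * 𝓑 G

{-# OPTIONS --safe #-}

-- Color the vertices one after the other. A vertex without earlier neighbor, following k used
-- colors, takes one of them or a new one; a vertex with one earlier neighbor has k - 1 old
-- colors to choose from instead. Hence S(G, ·) is obtained by applying one of two operators U
-- and M per vertex. As U = M + 1, they commute, and 𝓑 and 𝓣 depend only on n and the number p
-- of edges: they are φ(1) and φ(M 1), where φ applies M p times and U n - 1 - p times, and
-- evaluates at the state with one color. Write φ = ψ ∘ U and let M replace this U, which turns
-- two isolated vertices into an edge: the mean increases strictly if and only if
-- ψ(M 1)² < ψ(1) ψ(M² 1). With f = M 1 we have M² 1 = f² + 1, so this is the Cauchy–Schwarz
-- inequality for the positive functional ψ, made strict by the 1.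
-- It remains to maximise p: 2p + s = n, where s counts the isolated vertices, so p is maximal
-- as soon as s ≤ 1, and then G is the matching graph.
module Submission where

open import Defs hiding (sym)
open import Algebra.Properties.CommutativeMonoid.Sum as Sum using ()
open import Data.Bool using (Bool; true; false; if_then_else_; _∧_; _∨_; not; T)
open import Data.Bool.ListAction using (all; any; or)
open import Data.Bool.Properties
  using ( T-≡; T-∧; T-∨; T-not-≡; if-float; ∨-assoc; ∧-assoc; ∨-identityʳ; ∧-identityʳ; ∧-zeroʳ
        ; ∨-conicalʳ; ¬-not )
  renaming (_≟_ to _≟ᵇ_)
open import Data.Empty using (⊥-elim)
open import Data.Fin using (Fin; zero; suc; toℕ; fromℕ<; punchOut)
open import Data.Fin.Permutation using (Permutation′; permutation; _⟨$⟩ʳ_; _⟨$⟩ˡ_; inverseˡ; inverseʳ)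
open import Data.Fin.Properties
  using (toℕ<n; toℕ-injective; toℕ-fromℕ<; any?; injective⇒≤; punchOut-injective)
  renaming (_≟_ to _≟ᶠ_; <-cmp to <ᶠ-cmp; suc-injective to sucᶠ-injective)
open import Data.List
  using (List; []; _∷_; _++_; map; concatMap; tabulate; allFin; applyUpTo; length; filterᵇ)
open import Data.List.Properties using (map-applyUpTo; map-cong; map-tabulate; filter-++; length-++)
open import Data.List.Relation.Unary.All.Properties as All using ()
open import Data.List.Relation.Unary.Any.Properties as Any using ()
open import Data.Nat
  using (ℕ; zero; suc; pred; _+_; _*_; _/_; _%_; _≤_; _<_; z≤n; s≤s; s≤s⁻¹; _≡ᵇ_; _<ᵇ_; >-nonZero)
open import Data.Nat.Divisibility using (n∣m*n)
open import Data.Nat.DivMod using (m≡m%n+[m/n]*n; m%n<n; m*n/n≡m; +-distrib-/-∣ʳ)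
open import Data.Nat.ListAction using (sum)
open import Data.Nat.Properties
open import Data.Nat.Tactic.RingSolver using (solve-∀)
open import Data.Product using (Σ; _,_; _×_; proj₁; proj₂; ∃; ∃₂)
open import Data.Sum using (_⊎_; inj₁; inj₂; [_,_]′)
open import Data.Vec using (Vec; []; _∷_; lookup)
open import Function using (_∘_; id; const)
open import Function.Bundles using (_⇔_; mk⇔; Equivalence)
open import Function.Definitions using (Injective)
open import Relation.Binary using (tri<; tri≈; tri>)
open import Relation.Binary.PropositionalEquality
open import Relation.Nullary using (yes; no; ¬_; contradiction)
open import Relation.Nullary.Decidable using (⌊_⌋; toWitness; fromWitness)

open Sum +-0-commutativeMonoid
  using (sum-cong-≗; sum-replicate-zero; ∑-distrib-+; sum-permute) renaming (sum to ∑)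
open Equivalence using (to; from)

𝟙 : Bool → ℕ
𝟙 b = if b then 1 else 0

-- Positive functionals and strict log-convexity

-- These are the laws of a sum with nonnegative weights that do not all vanish. Monotonicity in both
-- directions also gives invariance under pointwise equality.
record Positive (L : (ℕ → ℕ) → ℕ) : Set where
  field
    additive    : ∀ f g → L (λ k → f k + g k) ≡ L f + L g
    homogeneous : ∀ c f → L (λ k → c * f k) ≡ c * L f
    monotone    : ∀ {f g} → (∀ k → f k ≤ g k) → L f ≤ L g
    nonzero     : 0 < L (λ _ → 1)

  congruent : ∀ {f g} → f ≗ g → L f ≡ L g
  congruent f≗g = ≤-antisym (monotone (≤-reflexive ∘ f≗g)) (monotone (≤-reflexive ∘ sym ∘ f≗g))

  linear : (w : ℕ → ℕ) (δ : ℕ → ℕ → ℕ) (Ks : List ℕ) →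
    sum (map (λ K → w K * L (δ K)) Ks) ≡ L (λ k → sum (map (λ K → w K * δ K k) Ks))
  linear w δ []       = sym (homogeneous 0 (λ _ → 0))
  linear w δ (K ∷ Ks) = begin
    w K * L (δ K) + sum (map (λ K → w K * L (δ K)) Ks)
      ≡⟨ cong₂ _+_ (sym (homogeneous (w K) (δ K))) (linear w δ Ks) ⟩
    L (λ k → w K * δ K k) + L (λ k → sum (map (λ K → w K * δ K k) Ks))
      ≡⟨ additive _ _ ⟨
    L (λ k → w K * δ K k + sum (map (λ K → w K * δ K k) Ks)) ∎
    where open ≡-Reasoning

-- The difference of the two sides is d², with d the distance of x and y; writing the larger number
-- as the smaller plus d avoids subtraction.
2xy≤x²+y² : ∀ x y → 2 * (x * y) ≤ x * x + y * y
2xy≤x²+y² x y with ≤-total x y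
... | inj₁ x≤y with d , refl ← m≤n⇒∃[o]m+o≡n x≤y = begin
  2 * (x * (x + d))                 ≤⟨ m≤m+n _ (d * d) ⟩
  2 * (x * (x + d)) + d * d         ≡⟨ square x d ⟩
  x * x + (x + d) * (x + d)         ∎
  where
  open ≤-Reasoning
  square : ∀ x d → 2 * (x * (x + d)) + d * d ≡ x * x + (x + d) * (x + d)
  square = solve-∀
... | inj₂ y≤x with d , refl ← m≤n⇒∃[o]m+o≡n y≤x = begin
  2 * ((y + d) * y)                 ≤⟨ m≤m+n _ (d * d) ⟩
  2 * ((y + d) * y) + d * d         ≡⟨ square y d ⟩
  (y + d) * (y + d) + y * y         ∎
  where
  open ≤-Reasoning
  square : ∀ y d → 2 * ((y + d) * y) + d * d ≡ (y + d) * (y + d) + y * y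
  square = solve-∀

-- Nonnegativity of the variance: `L` is applied to 2(bf)a ≤ (bf)² + a² with a = L f and b = L 1,
-- and then the factor b and the summand a² are cancelled.
cauchy-schwarz : ∀ {L} → Positive L → ∀ f →
  L f * L f ≤ L (λ _ → 1) * L (λ k → f k * f k)
cauchy-schwarz {L} pos f = +-cancelʳ-≤ (a * a) _ _ (*-cancelˡ-≤ b ⦃ >-nonZero nonzero ⦄ scaled)
  where
  open Positive pos
  open ≤-Reasoning
  a = L f
  b = L (λ _ → 1)
  regroupˡ : ∀ a b → b * (a * a + a * a) ≡ 2 * (b * a) * a
  regroupˡ = solve-∀
  regroupᵐ : ∀ a b x → 2 * (b * a) * x ≡ 2 * (b * x * a)
  regroupᵐ = solve-∀
  regroupʳ : ∀ b x → b * x * (b * x) ≡ b * b * (x * x)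
  regroupʳ = solve-∀
  collect : ∀ a b c → b * b * c + a * a * b ≡ b * (b * c + a * a)
  collect = solve-∀
  scaled : b * (a * a + a * a) ≤ b * (b * L (λ k → f k * f k) + a * a)
  scaled = begin
    b * (a * a + a * a)          ≡⟨ regroupˡ a b ⟩
    2 * (b * a) * a              ≡⟨ homogeneous (2 * (b * a)) f ⟨
    L (λ k → 2 * (b * a) * f k)  ≤⟨ monotone (λ k → begin
      2 * (b * a) * f k                      ≡⟨ regroupᵐ a b (f k) ⟩
      2 * (b * f k * a)                      ≤⟨ 2xy≤x²+y² (b * f k) a ⟩
      b * f k * (b * f k) + a * a            ≡⟨ cong₂ _+_ (regroupʳ b (f k)) (sym (*-identityʳ (a * a))) ⟩
      b * b * (f k * f k) + a * a * 1        ∎) ⟩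
    L (λ k → b * b * (f k * f k) + a * a * 1)
      ≡⟨ additive _ _ ⟩
    L (λ k → b * b * (f k * f k)) + L (λ _ → a * a * 1)
      ≡⟨ cong₂ _+_ (homogeneous (b * b) _) (homogeneous (a * a) _) ⟩
    b * b * L (λ k → f k * f k) + a * a * b
      ≡⟨ collect a b _ ⟩
    b * (b * L (λ k → f k * f k) + a * a) ∎

-- Let h k be a number of completions of a coloring that has used k colors. If the next
-- vertex can take a k of these colors, or a new one, there are Op a h k completions from it.
Op : (ℕ → ℕ) → (ℕ → ℕ) → ℕ → ℕ
Op a h k = a k * h k + h (suc k)

Op-positive : ∀ {L} a → Positive L → Positive (L ∘ Op a)
Op-positive {L} a pos = record
  { additive    = λ f g → trans (congruent (λ k → add (a k) (f k) (g k) _ _)) (additive _ _)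
  ; homogeneous = λ c f → trans (congruent (λ k → scale (a k) c (f k) _)) (homogeneous c _)
  ; monotone    = λ f≤g → monotone (λ k → +-mono-≤ (*-monoʳ-≤ (a k) (f≤g k)) (f≤g (suc k)))
  ; nonzero     = ≤-trans nonzero (monotone (λ k → m≤n+m 1 (a k * 1)))
  }
  where
  open Positive pos
  add : ∀ a x y x′ y′ → a * (x + y) + (x′ + y′) ≡ (a * x + x′) + (a * y + y′)
  add = solve-∀
  scale : ∀ a c x x′ → a * (c * x) + c * x′ ≡ c * (a * x + x′)
  scale = solve-∀

-- M adds a vertex with an earlier neighbor, U one without; the argument is one less than
-- the number of colors, so that no truncated subtraction occurs and U = M + 1.
M U : (ℕ → ℕ) → ℕ → ℕ
M = Op id
U = Op suc

-- This is U^q M^p applied to `h`. Each recursive call puts the operator directly on `h`, so that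
-- positivity passes from `L` to `L ∘ Op a`.
V : ℕ → ℕ → (ℕ → ℕ) → ℕ → ℕ
V zero    zero    h = h
V zero    (suc q) h = V zero q (U h)
V (suc p) q       h = V p q (M h)

V-positive : ∀ p q k → Positive (λ h → V p q h k)
V-positive zero    zero    k = record
  { additive = λ _ _ → refl ; homogeneous = λ _ _ → refl ; monotone = λ f≤g → f≤g k ; nonzero = s≤s z≤n }
V-positive zero    (suc q) k = Op-positive suc (V-positive zero q k)
V-positive (suc p) q       k = Op-positive id (V-positive p q k)

-- Each operator looks one argument ahead, so `p + q` of them, evaluated at `k`, read `h` only up to
-- `k + (p + q)`.
V-local : ∀ p q {h h′} k → (∀ j → j ≤ k + (p + q) → h j ≡ h′ j) → V p q h k ≡ V p q h′ k
V-local zero zero k eq = eq k (m≤m+n k 0)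
V-local zero (suc q) k eq = V-local zero q k λ j j≤ → cong₂ (λ x y → suc j * x + y)
  (eq j (≤-trans j≤ (+-monoʳ-≤ k (n≤1+n q))))
  (eq (suc j) (≤-trans (s≤s j≤) (≤-reflexive (sym (+-suc k q)))))
V-local (suc p) q k eq = V-local p q k λ j j≤ → cong₂ (λ x y → j * x + y)
  (eq j (≤-trans j≤ (+-monoʳ-≤ k (n≤1+n (p + q)))))
  (eq (suc j) (≤-trans (s≤s j≤) (≤-reflexive (sym (+-suc k (p + q))))))

U-V : ∀ p q h k → U (V p q h) k ≡ V p (suc q) h k
U-V zero    zero    h k = refl
U-V zero    (suc q) h k = U-V zero q (U h) k
U-V (suc p) q       h k = U-V p q (M h) k

M-U-comm : ∀ h k → M (U h) k ≡ U (M h) k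
M-U-comm h k = expand k (h k) (h (suc k)) (h (suc (suc k)))
  where
  expand : ∀ k x y z → k * (suc k * x + y) + (suc (suc k) * y + z) ≡ suc k * (k * x + y) + (suc k * y + z)
  expand = solve-∀

V-congruent : ∀ p q k {f g} → f ≗ g → V p q f k ≡ V p q g k
V-congruent p q k = Positive.congruent (V-positive p q k)

-- The operator of the first vertex arrives from outside, while `V` holds `M` innermost; commutation
-- carries it past every `U`.
M-V : ∀ p q h k → M (V p q h) k ≡ V (suc p) q h k
M-V zero    zero    h k = refl
M-V zero    (suc q) h k = trans (M-V zero q (U h) k) (V-congruent zero q k (M-U-comm h))
M-V (suc p) q       h k = M-V p q (M h) k

V-suc-q : ∀ p q h k → V p (suc q) h k ≡ V p q (U h) k
V-suc-q zero    q h k = refl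
V-suc-q (suc p) q h k = trans (V-suc-q p q (M h) k) (V-congruent p q k (sym ∘ M-U-comm h))

U≗M+1 : ∀ h k → U h k ≡ M h k + h k
U≗M+1 h k = expand (h k) (k * h k) (h (suc k))
  where
  expand : ∀ x y z → x + y + z ≡ y + z + x
  expand = solve-∀

-- Deletion-contraction, from U = M + 1: without the edge, its two ends have either different colors
-- or the same one.
V-recurrence : ∀ p q h → V p (suc q) h 0 ≡ V (suc p) q h 0 + V p q h 0
V-recurrence p q h = trans (V-suc-q p q h 0)
  (trans (V-congruent p q 0 (U≗M+1 h)) (Positive.additive (V-positive p q 0) (M h) h))

-- 𝓣 and 𝓑 of pK₂ ∪ rK₁ with 2p + r = p + q + 1; evaluation at 0 means one used color.
blocks : ℕ → ℕ → ℕ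
blocks p q = V p q suc 0

partitions : ℕ → ℕ → ℕ
partitions p q = V p q (λ _ → 1) 0

partitions>0 : ∀ p q → 0 < partitions p q
partitions>0 p q = Positive.nonzero (V-positive p q 0)

-- `M` sends the constant 1 to `suc`. So with `q` fixed, the mean is the ratio of two consecutive
-- values of `partitions`, and log-convexity concerns three of them.
partitions-suc : ∀ p q → partitions (suc p) q ≡ blocks p q
partitions-suc p q = V-congruent p q 0 λ k → trans (cong (_+ 1) (*-identityʳ k)) (+-comm k 1)

log-convex : ∀ p q → blocks p q * blocks p q < partitions p q * blocks (suc p) q
log-convex p q = begin-strict
  t * t                                     ≤⟨ cauchy-schwarz (V-positive p q 0) suc ⟩
  b * V p q (λ k → suc k * suc k) 0         ≡⟨ +-identityʳ _ ⟨
  -- The slack `b * b` comes from the constant 1 by which `M suc` exceeds the square of `suc`.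
  b * V p q (λ k → suc k * suc k) 0 + 0     <⟨ +-monoʳ-< _ (*-mono-< (partitions>0 p q) (partitions>0 p q)) ⟩
  b * V p q (λ k → suc k * suc k) 0 + b * b ≡⟨ *-distribˡ-+ b _ _ ⟨
  b * (V p q (λ k → suc k * suc k) 0 + b)   ≡⟨ cong (b *_) (additive _ (λ _ → 1)) ⟨
  b * V p q (λ k → suc k * suc k + 1) 0     ≡⟨ cong (b *_) (congruent M-suc) ⟨
  b * blocks (suc p) q                      ∎
  where
  open ≤-Reasoning
  open Positive (V-positive p q 0)
  t = blocks p q
  b = partitions p q
  M-suc : ∀ k → k * suc k + suc (suc k) ≡ suc k * suc k + 1
  M-suc = solve-∀

-- By `V-recurrence` both products contain `s * t`, with s, t and b as below; what is left is
-- `t * t < b * s`.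
mean-step : ∀ p q → blocks p (suc q) * partitions (suc p) q < blocks (suc p) q * partitions p (suc q)
mean-step p q rewrite V-recurrence p q suc | V-recurrence p q (λ _ → 1) | partitions-suc p q = begin-strict
  (s + t) * t   ≡⟨ *-distribʳ-+ t s t ⟩
  s * t + t * t <⟨ +-monoʳ-< (s * t) (log-convex p q) ⟩
  s * t + b * s ≡⟨ cong (s * t +_) (*-comm b s) ⟩
  s * t + s * b ≡⟨ *-distribˡ-+ s t b ⟨
  s * (t + b)   ∎
  where
  open ≤-Reasoning
  s = blocks (suc p) q
  t = blocks p q
  b = partitions p q

-- To be read as a/b < c/d < e/f; the middle denominator is cancelled at the end.
ratio-<-trans : ∀ {a b c d e f} → 0 < b → 0 < d → 0 < f →
  a * d < c * b → c * f < e * d → a * f < e * b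
ratio-<-trans {a} {b} {c} {d} {e} {f} b>0 d>0 f>0 ad<cb cf<ed = *-cancelʳ-< d _ _ (begin-strict
  a * f * d ≡⟨ swap a f d ⟩
  a * d * f <⟨ *-monoˡ-< f ⦃ >-nonZero f>0 ⦄ ad<cb ⟩
  c * b * f ≡⟨ swap c b f ⟩
  c * f * b <⟨ *-monoˡ-< b ⦃ >-nonZero b>0 ⦄ cf<ed ⟩
  e * d * b ≡⟨ swap e d b ⟩
  e * b * d ∎)
  where
  open ≤-Reasoning
  swap : ∀ x y z → x * y * z ≡ x * z * y
  swap = solve-∀

-- Each of the `suc d` steps exchanges one `U` for one `M`, which keeps the number of vertices.
mean-strictly-increasing : ∀ p q d →
  blocks p (suc d + q) * partitions (suc d + p) q < blocks (suc d + p) q * partitions p (suc d + q)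
mean-strictly-increasing p q zero    = mean-step p q
mean-strictly-increasing p q (suc d) =
  ratio-<-trans {a = blocks p (2 + d + q)} {c = blocks (suc d + p) (suc q)} {e = blocks (2 + d + p) q}
    (partitions>0 p (2 + d + q)) (partitions>0 (suc d + p) (suc q)) (partitions>0 (2 + d + p) q)
    (subst (λ r → blocks p r * partitions (suc d + p) (suc q) < blocks (suc d + p) (suc q) * partitions p r)
      (+-suc (suc d) q) (mean-strictly-increasing p (suc q) d))
    (mean-step (suc d + p) q)

-- Sums over the number of colors

private
  sum-zeros : ∀ f n → (∀ i → f i ≡ 0) → sum (applyUpTo f n) ≡ 0
  sum-zeros f zero    f≡0 = refl
  sum-zeros f (suc n) f≡0 = cong₂ _+_ (f≡0 0) (sum-zeros (f ∘ suc) n (f≡0 ∘ suc))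

sum-indicator : ∀ w {k n} → k < n → sum (applyUpTo (λ i → w i * 𝟙 (k ≡ᵇ i)) n) ≡ w k
sum-indicator w {zero}  {suc n} k<n = trans
  (cong₂ _+_ (*-identityʳ (w 0)) (sum-zeros _ n (λ i → *-zeroʳ (w (suc i))))) (+-identityʳ (w 0))
sum-indicator w {suc k} {suc n} k<n =
  trans (cong (_+ sum (applyUpTo (λ i → w (suc i) * 𝟙 (k ≡ᵇ i)) n)) (*-zeroʳ (w 0)))
    (sum-indicator (w ∘ suc) (s≤s⁻¹ k<n))

-- Linearity moves the weighted sum over `K` inside, where the indicator picks out `w (suc k)`. The
-- range up to `suc (p + q)` suffices because `V-local` bounds the arguments that are read.
V-expand : ∀ w p q →
  sum (map (λ K → w K * V p q (λ k → 𝟙 (suc k ≡ᵇ K)) 0) (oneTo (suc (p + q)))) ≡ V p q (w ∘ suc) 0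
V-expand w p q = trans (Positive.linear (V-positive p q 0) w (λ K k → 𝟙 (suc k ≡ᵇ K)) (oneTo (suc (p + q))))
  (V-local p q 0 λ k k≤ → trans (reindex k) (sum-indicator (w ∘ suc) (s≤s k≤)))
  where
  n = suc (p + q)
  term : ℕ → ℕ → ℕ
  term k K = w K * 𝟙 (suc k ≡ᵇ K)
  reindex : ∀ k → sum (map (term k) (oneTo n)) ≡ sum (applyUpTo (term k ∘ suc) n)
  reindex k = cong sum (trans (cong (map (term k)) (map-applyUpTo id suc n)) (map-applyUpTo suc (term k) n))

-- Canonical colorings, vertex by vertex

T⇔→≡ : ∀ {x y} → (T x ⇔ T y) → x ≡ y
T⇔→≡ {true}  {true}  _ = refl
T⇔→≡ {true}  {false} e = ⊥-elim (to e _)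
T⇔→≡ {false} {true}  e = ⊥-elim (from e _)
T⇔→≡ {false} {false} _ = refl

count-∷ : ∀ {A : Set} (p : A → Bool) x xs → count p (x ∷ xs) ≡ 𝟙 (p x) + count p xs
count-∷ p x xs with p x
... | true  = refl
... | false = refl

count-cong : ∀ {A : Set} {p q : A → Bool} → p ≗ q → count p ≗ count q
count-cong         p≗q []       = refl
count-cong {p = p} {q} p≗q (x ∷ xs) = begin
  count p (x ∷ xs)       ≡⟨ count-∷ p x xs ⟩
  𝟙 (p x) + count p xs ≡⟨ cong₂ (λ b s → 𝟙 b + s) (p≗q x) (count-cong p≗q xs) ⟩
  𝟙 (q x) + count q xs ≡⟨ count-∷ q x xs ⟨
  count q (x ∷ xs)       ∎
  where open ≡-Reasoning

count-map : ∀ {A B : Set} (p : B → Bool) (f : A → B) xs → count p (map f xs) ≡ count (p ∘ f) xs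
count-map p f []       = refl
count-map p f (x ∷ xs) = trans (count-∷ p (f x) (map f xs))
  (trans (cong (𝟙 (p (f x)) +_) (count-map p f xs)) (sym (count-∷ (p ∘ f) x xs)))

count-++ : ∀ {A : Set} (p : A → Bool) xs ys → count p (xs ++ ys) ≡ count p xs + count p ys
count-++ p xs ys = trans (cong length (filter-++ _ xs ys)) (length-++ (filterᵇ p xs))

count-∧ : ∀ {A : Set} b (p : A → Bool) xs → count (λ x → b ∧ p x) xs ≡ 𝟙 b * count p xs
count-∧ true  p xs       = sym (*-identityˡ _)
count-∧ false p []       = refl
count-∧ false p (x ∷ xs) = count-∧ false p xs

count-tabulate : ∀ {A : Set} {n} (p : A → Bool) (f : Fin n → A) → count p (tabulate f) ≡ ∑ (𝟙 ∘ p ∘ f)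
count-tabulate {n = zero}  p f = refl
count-tabulate {n = suc n} p f =
  trans (count-∷ p (f zero) _) (cong (𝟙 (p (f zero)) +_) (count-tabulate p (f ∘ suc)))

count-concatMap : ∀ {A B : Set} {n} (p : B → Bool) (g : A → List B) (f : Fin n → A) →
  count p (concatMap g (tabulate f)) ≡ ∑ (λ i → count p (g (f i)))
count-concatMap {n = zero}  p g f = refl
count-concatMap {n = suc n} p g f =
  trans (count-++ p (g (f zero)) _) (cong (count p (g (f zero)) +_) (count-concatMap p g (f ∘ suc)))

count-allVecs : ∀ {m n} (p : Vec (Fin m) (suc n) → Bool) →
  count p (allVecs m (suc n)) ≡ ∑ (λ x → count (p ∘ (x ∷_)) (allVecs m n))
count-allVecs {m} {n} p = trans (count-concatMap p (λ x → map (x ∷_) (allVecs m n)) id)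
  (sum-cong-≗ (λ x → count-map p (x ∷_) (allVecs m n)))

T-all : ∀ {n} {p : Fin n → Bool} → T (all p (allFin n)) ⇔ (∀ i → T (p i))
T-all {p = p} = mk⇔ (λ t → All.tabulate⁻ (All.all⁺ p _ t)) (λ t → All.all⁻ p (All.tabulate⁺ t))

T-any : ∀ {n} {p : Fin n → Bool} → T (any p (allFin n)) ⇔ ∃ λ i → T (p i)
T-any {p = p} = mk⇔ (λ t → Any.tabulate⁻ (Any.any⁻ p _ t)) (λ (i , t) → Any.any⁺ p (Any.tabulate⁺ i t))

any-suc : ∀ {n} (p : Fin (suc n) → Bool) → any p (allFin (suc n)) ≡ p zero ∨ any (p ∘ suc) (allFin n)
any-suc p = cong (λ bs → p zero ∨ or bs) (trans (map-tabulate suc p) (sym (map-tabulate id (p ∘ suc))))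

∑-<ᵇ : ∀ {m} k → k ≤ m → ∑ {m} (λ x → 𝟙 (toℕ x <ᵇ k)) ≡ k
∑-<ᵇ {m} zero    k≤m       = sum-replicate-zero m
∑-<ᵇ     (suc k) (s≤s k≤m) = cong suc (∑-<ᵇ k k≤m)

∑-single : ∀ {m} a (y : Fin m) → ∑ (λ x → 𝟙 ⌊ x ≟ᶠ y ⌋ * a) ≡ a
∑-single {suc m} a zero    = trans (cong₂ _+_ (*-identityˡ a) (sum-replicate-zero m)) (+-identityʳ a)
∑-single {suc m} a (suc y) = trans (sum-cong-≗ {m} {_} {λ x → 𝟙 ⌊ x ≟ᶠ y ⌋ * a} shift) (∑-single a y)
  where
  shift : ∀ x → 𝟙 ⌊ suc x ≟ᶠ suc y ⌋ * a ≡ 𝟙 ⌊ x ≟ᶠ y ⌋ * a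
  shift x with x ≟ᶠ y
  ... | yes _ = refl
  ... | no _  = refl

tailᴳ : ∀ {n} → Graph (suc n) → Graph n
tailᴳ G = record
  { adj    = λ i j → adj G (suc i) (suc j)
  ; sym    = λ i j → Defs.sym G (suc i) (suc j)
  ; irrefl = λ i → irrefl G (suc i)
  }

-- The colors in use are those below `k`, so color `k` is the next new one.
step : ∀ {m} → ℕ → Fin m → ℕ
step k x = if toℕ x ≡ᵇ k then suc k else k

-- How a coloring c extends a canonical coloring, with colors 0, …, k - 1, of vertices that
-- come before; forb i y says that some earlier neighbor of i has color y.
record Extends {m n} (G : Graph n) (forb : Fin n → Fin m → Bool) (k : ℕ) (c : Fin n → Fin m) : Set where
  field
    proper    : ∀ i j → adj G i j ≡ true → c i ≢ c j
    avoids    : ∀ i → forb i (c i) ≡ false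
    canonical : ∀ i → toℕ (c i) ≤ k ⊎ ∃ λ j → toℕ j < toℕ i × suc (toℕ (c j)) ≡ toℕ (c i)

-- Removing vertex `zero` must not lose its constraint: its color becomes forbidden for its
-- neighbors.
bar : ∀ {m n} → Graph (suc n) → (Fin (suc n) → Fin m → Bool) → Fin m → Fin n → Fin m → Bool
bar G forb x i y = (adj G zero (suc i) ∧ ⌊ y ≟ᶠ x ⌋) ∨ forb (suc i) y

allows : ∀ {m} → (Fin m → Bool) → ℕ → Fin m → Bool
allows f k x = (toℕ x <ᵇ suc k) ∧ not (f x)

-- Decides `Extends` one vertex at a time, so that counts split according to the color of the first
-- vertex.
extends? : ∀ {m n} → Graph n → (Fin n → Fin m → Bool) → ℕ → Vec (Fin m) n → Bool
extends? G forb k []      = true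
extends? G forb k (x ∷ v) = allows (forb zero) k x ∧ extends? (tailᴳ G) (bar G forb x) (step k x) v

step-≡ : ∀ {m k} {x : Fin m} → toℕ x ≡ k → step k x ≡ suc k
step-≡ {k = k} {x} eq with toℕ x ≡ᵇ k | ≡⇒≡ᵇ (toℕ x) k eq
... | true | _ = refl

step-≢ : ∀ {m k} {x : Fin m} → toℕ x ≢ k → step k x ≡ k
step-≢ {k = k} {x} neq with toℕ x ≡ᵇ k in eq
... | true  = contradiction (≡ᵇ⇒≡ (toℕ x) k (subst T (sym eq) _)) neq
... | false = refl

data StepView {m} (k : ℕ) (x : Fin m) : ℕ → Set where
  new : toℕ x ≡ k → StepView k x (suc k)
  old : toℕ x < k → StepView k x k

stepView : ∀ {m k} {x : Fin m} → toℕ x ≤ k → StepView k x (step k x)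
stepView {k = k} {x} x≤k with toℕ x ≟ k
... | yes eq rewrite step-≡ {x = x} eq = new eq
... | no neq rewrite step-≢ {x = x} neq = old (≤∧≢⇒< x≤k neq)

x<step : ∀ {m k} {x : Fin m} → toℕ x ≤ k → toℕ x < step k x
x<step {k = k} {x} x≤k with step k x | stepView x≤k
... | _ | new refl = ≤-refl
... | _ | old x<k  = x<k

k≤step : ∀ {m k} {x : Fin m} → toℕ x ≤ k → k ≤ step k x
k≤step {k = k} {x} x≤k with step k x | stepView x≤k
... | _ | new _ = n≤1+n k
... | _ | old _ = ≤-refl

step≤1+k : ∀ {m k} {x : Fin m} → toℕ x ≤ k → step k x ≤ suc k
step≤1+k {k = k} {x} x≤k with step k x | stepView x≤k
... | _ | new _ = ≤-refl
... | _ | old _ = n≤1+n k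

T-allows : ∀ {m} (f : Fin m → Bool) {k} {x : Fin m} → T (allows f k x) ⇔ (toℕ x ≤ k × f x ≡ false)
T-allows f = mk⇔
  (λ t → let s , u = to T-∧ t in s≤s⁻¹ (<ᵇ⇒< _ _ s) , to T-not-≡ u)
  (λ (x≤k , f≢x) → from T-∧ (<⇒<ᵇ (s≤s x≤k) , from T-not-≡ f≢x))

≟-refl : ∀ {m} (x : Fin m) → ⌊ x ≟ᶠ x ⌋ ≡ true
≟-refl x = cong ⌊_⌋ (≡-≟-identity _≟ᶠ_ refl)

≟-≢ : ∀ {m} {x y : Fin m} → x ≢ y → ⌊ x ≟ᶠ y ⌋ ≡ false
≟-≢ x≢y = cong ⌊_⌋ (≢-≟-identity _≟ᶠ_ x≢y)

-- Properness towards vertex `zero` turns into avoidance of `x`. For canonicity, raising the bound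
-- from `k` to `step k x` accounts for the vertices whose predecessor was vertex `zero`.
Extends-cons : ∀ {m n} (G : Graph (suc n)) (forb : Fin (suc n) → Fin m → Bool) k x (v : Vec (Fin m) n) →
  Extends G forb k (lookup (x ∷ v)) ⇔
  ((toℕ x ≤ k × forb zero x ≡ false) × Extends (tailᴳ G) (bar G forb x) (step k x) (lookup v))
Extends-cons {m} {n} G forb k x v = mk⇔ split join
  where
  c = lookup (x ∷ v)
  Parts = (toℕ x ≤ k × forb zero x ≡ false) × Extends (tailᴳ G) (bar G forb x) (step k x) (lookup v)
  split : Extends G forb k c → Parts
  split e = (x≤k , avoids zero) , record
    { proper = λ i j → proper (suc i) (suc j) ; avoids = avoids′ ; canonical = canonical′ }
    where
    open Extends e
    x≤k : toℕ x ≤ k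
    x≤k with canonical zero
    ... | inj₁ le = le
    avoids′ : ∀ i → bar G forb x i (lookup v i) ≡ false
    avoids′ i rewrite avoids (suc i) with adj G zero (suc i) in eq
    ... | true  = trans (∨-identityʳ _) (≟-≢ (proper zero (suc i) eq ∘ sym))
    ... | false = refl
    canonical′ : ∀ i → toℕ (lookup v i) ≤ step k x ⊎
      ∃ λ j → toℕ j < toℕ i × suc (toℕ (lookup v j)) ≡ toℕ (lookup v i)
    canonical′ i with canonical (suc i)
    ... | inj₁ le                 = inj₁ (≤-trans le (k≤step x≤k))
    ... | inj₂ (zero  , _   , eq) = inj₁ (≤-trans (≤-reflexive (sym eq)) (x<step x≤k))
    ... | inj₂ (suc j , j<i , eq) = inj₂ (j , s≤s⁻¹ j<i , eq)
  join : Parts → Extends G forb k c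
  join ((x≤k , f≢x) , e) = record { proper = proper′ ; avoids = avoids′ ; canonical = canonical′ }
    where
    open Extends e
    first : ∀ i → adj G zero (suc i) ≡ true → x ≢ lookup v i
    first i eq refl with avoids i
    ... | f rewrite eq | ≟-refl x = contradiction f λ ()
    proper′ : ∀ i j → adj G i j ≡ true → c i ≢ c j
    proper′ zero    zero    a = contradiction (trans (sym a) (irrefl G zero)) λ ()
    proper′ zero    (suc j) a = first j a
    proper′ (suc i) zero    a = first i (trans (Defs.sym G zero (suc i)) a) ∘ sym
    proper′ (suc i) (suc j) a = proper i j a
    avoids′ : ∀ i → forb i (c i) ≡ false
    avoids′ zero    = f≢x
    avoids′ (suc i) = ∨-conicalʳ _ _ (avoids i)
    canonical′ : ∀ i → toℕ (c i) ≤ k ⊎ ∃ λ j → toℕ j < toℕ i × suc (toℕ (c j)) ≡ toℕ (c i)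
    canonical′ zero = inj₁ x≤k
    canonical′ (suc i) with canonical i
    ... | inj₂ (j , j<i , eq) = inj₂ (suc j , s≤s j<i , eq)
    ... | inj₁ le with step k x | stepView x≤k
    ...   | _ | old _ = inj₁ le
    ...   | _ | new eq with m≤n⇒m<n∨m≡n le
    ...     | inj₁ lt = inj₁ (s≤s⁻¹ lt)
    -- The only color above the old bound is `suc k`; vertex `zero` has just introduced its
    -- predecessor `k`.
    ...     | inj₂ c≡ = inj₂ (zero , s≤s z≤n , trans (cong suc eq) (sym c≡))

T-extends? : ∀ {m n} (G : Graph n) (forb : Fin n → Fin m → Bool) k v →
  T (extends? G forb k v) ⇔ Extends G forb k (lookup v)
T-extends? G forb k [] = mk⇔ (λ _ → record { proper = λ () ; avoids = λ () ; canonical = λ () }) _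
T-extends? G forb k (x ∷ v) = mk⇔
  (λ t → let s , u = to T-∧ t in
     from (Extends-cons G forb k x v) (to (T-allows (forb zero)) s , to (T-extends? _ _ (step k x) v) u))
  (λ e → let s , u = to (Extends-cons G forb k x v) e in
     from T-∧ (from (T-allows (forb zero)) s , from (T-extends? _ _ (step k x) v) u))

-- The colors below `k` count as used already; for `k = 0` this unfolds to `numBlocks`.
colorsUsed : ∀ {m n} → ℕ → (Fin n → Fin m) → ℕ
colorsUsed {m} {n} k c = count (λ y → (toℕ y <ᵇ k) ∨ any (λ i → ⌊ c i ≟ᶠ y ⌋) (allFin n)) (allFin m)

T-≟ : ∀ {m} {x y : Fin m} → T ⌊ x ≟ᶠ y ⌋ ⇔ x ≡ y
T-≟ = mk⇔ toWitness fromWitness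

<ᵇ-step : ∀ {m k} {x : Fin m} → toℕ x ≤ k → ∀ y → (toℕ y <ᵇ k) ∨ ⌊ x ≟ᶠ y ⌋ ≡ (toℕ y <ᵇ step k x)
<ᵇ-step {k = k} {x} x≤k y = T⇔→≡ (mk⇔ (<⇒<ᵇ ∘ ⇒ ∘ to T-∨) (from T-∨ ∘ ⇐ ∘ <ᵇ⇒< _ _))
  where
  ⇒ : T (toℕ y <ᵇ k) ⊎ T ⌊ x ≟ᶠ y ⌋ → toℕ y < step k x
  ⇒ (inj₁ t) = ≤-trans (<ᵇ⇒< _ _ t) (k≤step x≤k)
  ⇒ (inj₂ t) with refl ← to T-≟ t = x<step x≤k
  ⇐ : toℕ y < step k x → T (toℕ y <ᵇ k) ⊎ T ⌊ x ≟ᶠ y ⌋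
  ⇐ lt with step k x | stepView x≤k
  ... | _ | old _ = inj₁ (<⇒<ᵇ lt)
  ... | _ | new x≡k with m≤n⇒m<n∨m≡n (s≤s⁻¹ lt)
  ...   | inj₁ y<k = inj₁ (<⇒<ᵇ y<k)
  ...   | inj₂ y≡k = inj₂ (from T-≟ (toℕ-injective (trans x≡k (sym y≡k))))

colorsUsed-cons : ∀ {m n} {k} {x : Fin m} → toℕ x ≤ k → (v : Vec (Fin m) n) →
  colorsUsed k (lookup (x ∷ v)) ≡ colorsUsed (step k x) (lookup v)
colorsUsed-cons {m} {n} {k} {x} x≤k v = count-cong (λ y → begin
  (toℕ y <ᵇ k) ∨ any (λ i → ⌊ lookup (x ∷ v) i ≟ᶠ y ⌋) (allFin (suc n))
    ≡⟨ cong ((toℕ y <ᵇ k) ∨_) (any-suc (λ i → ⌊ lookup (x ∷ v) i ≟ᶠ y ⌋)) ⟩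
  (toℕ y <ᵇ k) ∨ (⌊ x ≟ᶠ y ⌋ ∨ used y)
    ≡⟨ ∨-assoc (toℕ y <ᵇ k) _ _ ⟨
  ((toℕ y <ᵇ k) ∨ ⌊ x ≟ᶠ y ⌋) ∨ used y
    ≡⟨ cong (_∨ used y) (<ᵇ-step x≤k y) ⟩
  (toℕ y <ᵇ step k x) ∨ used y ∎) (allFin m)
  where
  open ≡-Reasoning
  used : Fin m → Bool
  used y = any (λ i → ⌊ lookup v i ≟ᶠ y ⌋) (allFin n)

colorsUsed-[] : ∀ {m k} → k ≤ m → colorsUsed k (lookup {A = Fin m} []) ≡ k
colorsUsed-[] {m} {k} k≤m = trans (count-tabulate {n = m} (λ y → (toℕ y <ᵇ k) ∨ false) id)
  (trans (sum-cong-≗ {m} (λ y → cong 𝟙 (∨-identityʳ (toℕ y <ᵇ k)))) (∑-<ᵇ k k≤m))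

-- The colors that the earlier neighbors of i exclude: none, the color y of an earlier neighbor
-- that is already removed from G, or the color of an earlier neighbor j that is still in G.
data Source {m n} (G : Graph n) (forb : Fin n → Fin m → Bool) (k : ℕ) (i : Fin n) : Bool → Set where
  free   : (∀ x → forb i x ≡ false) → (∀ j → toℕ j < toℕ i → adj G j i ≡ false) → Source G forb k i false
  barred : ∀ y → toℕ y < k → (∀ x → forb i x ≡ ⌊ x ≟ᶠ y ⌋) → (∀ j → toℕ j < toℕ i → adj G j i ≡ false) →
           Source G forb k i true
  joined : ∀ j → toℕ j < toℕ i → adj G j i ≡ true → (∀ x → forb i x ≡ false) →
           (∀ j′ → adj G j′ i ≡ true → j′ ≡ j) → Source G forb k i true

-- Only a vertex joined to the removed one changes kind: it becomes barred from `x`, and uniqueness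
-- leaves it no neighbor still in the graph.
Source-tail : ∀ {m n} {G : Graph (suc n)} {forb : Fin (suc n) → Fin m → Bool} {k x} → toℕ x ≤ k → ∀ {i b} →
  Source G forb k (suc i) b → Source (tailᴳ G) (bar G forb x) (step k x) i b
Source-tail x≤k (free f≡ a≡) =
  free (λ y → cong₂ (λ a b → (a ∧ _) ∨ b) (a≡ zero (s≤s z≤n)) (f≡ y)) (λ j j<i → a≡ (suc j) (s≤s j<i))
Source-tail x≤k (barred y y<k f≡ a≡) =
  barred y (≤-trans y<k (k≤step x≤k)) (λ z → cong₂ (λ a b → (a ∧ _) ∨ b) (a≡ zero (s≤s z≤n)) (f≡ z))
    (λ j j<i → a≡ (suc j) (s≤s j<i))
Source-tail {G = G} {x = x} x≤k {i} (joined zero j<i a f≡ uniq) =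
  barred x (x<step x≤k) (λ z → trans (cong₂ (λ a b → (a ∧ _) ∨ b) a (f≡ z)) (∨-identityʳ _)) other
  where
  other : ∀ j → toℕ j < toℕ i → adj G (suc j) (suc i) ≡ false
  other j _ with adj G (suc j) (suc i) in eq
  ... | false = refl
  ... | true with () ← uniq (suc j) eq
Source-tail {G = G} x≤k {i} (joined (suc j) j<i a f≡ uniq) =
  joined j (s≤s⁻¹ j<i) a (λ z → cong₂ (λ a b → (a ∧ _) ∨ b) other (f≡ z))
    (λ j′ a′ → sucᶠ-injective (uniq (suc j′) a′))
  where
  other : adj G zero (suc i) ≡ false
  other with adj G zero (suc i) in eq
  ... | false = refl
  ... | true with () ← uniq zero eq

-- Counting the extensions of a coloring

options : Bool → ℕ → ℕ
options b k = if b then pred k else k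

∑-colors : ∀ {m} k a b → k < m →
  ∑ {m} (λ x → 𝟙 (toℕ x <ᵇ suc k) * (if toℕ x ≡ᵇ k then b else a)) ≡ k * a + b
∑-colors {suc m} zero    a b k<m = trans (cong₂ _+_ (*-identityˡ b) (sum-replicate-zero m)) (+-identityʳ b)
∑-colors {suc m} (suc k) a b k<m = begin
  1 * a + ∑ {m} (λ x → 𝟙 (toℕ x <ᵇ suc k) * (if toℕ x ≡ᵇ k then b else a))
    ≡⟨ cong₂ _+_ (*-identityˡ a) (∑-colors k a b (s≤s⁻¹ k<m)) ⟩
  a + (k * a + b)
    ≡⟨ +-assoc a _ _ ⟨
  a + k * a + b ∎
  where open ≡-Reasoning

-- An admissible old color keeps `k`, the new one raises it. The case `joined` is absent since
-- nothing precedes vertex `zero`.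
∑-allows : ∀ {m n} {G : Graph (suc n)} {forb : Fin (suc n) → Fin m → Bool} {k b} → k < m →
  Source G forb k zero b → ∀ E → ∑ (λ x → 𝟙 (allows (forb zero) k x) * E (step k x)) ≡ Op (options b) E k
∑-allows {m} {forb = forb} {k} k<m source E = go source
  where
  open ≡-Reasoning
  weight : Fin m → ℕ
  weight x = 𝟙 (toℕ x <ᵇ suc k) * E (step k x)
  total : ∑ weight ≡ k * E k + E (suc k)
  total = trans (sum-cong-≗ {m} (λ x → cong (𝟙 (toℕ x <ᵇ suc k) *_) (if-float E (toℕ x ≡ᵇ k))))
    (∑-colors k (E k) (E (suc k)) k<m)
  unrestricted : (∀ x → forb zero x ≡ false) → ∀ x → 𝟙 (allows (forb zero) k x) * E (step k x) ≡ weight x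
  unrestricted f≡ x rewrite f≡ x = cong (λ b → 𝟙 b * E (step k x)) (∧-identityʳ (toℕ x <ᵇ suc k))
  restricted : ∀ y → toℕ y < k → (∀ x → forb zero x ≡ ⌊ x ≟ᶠ y ⌋) → ∀ x →
    𝟙 (allows (forb zero) k x) * E (step k x) + 𝟙 ⌊ x ≟ᶠ y ⌋ * E k ≡ weight x
  restricted y y<k f≡ x rewrite f≡ x with x ≟ᶠ y
  ... | no _ = trans (+-identityʳ _) (cong (λ b → 𝟙 b * E (step k x)) (∧-identityʳ (toℕ x <ᵇ suc k)))
  ... | yes refl = begin
    𝟙 ((toℕ x <ᵇ suc k) ∧ false) * E (step k x) + 1 * E k
      ≡⟨ cong₂ (λ b e → 𝟙 b * E (step k x) + e) (∧-zeroʳ (toℕ x <ᵇ suc k)) (*-identityˡ (E k)) ⟩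
    E k
      ≡⟨ *-identityˡ (E k) ⟨
    1 * E k
      ≡⟨ cong₂ (λ b l → 𝟙 b * E l) (to T-≡ (<⇒<ᵇ (m<n⇒m<1+n y<k))) (step-≢ {x = x} (<⇒≢ y<k)) ⟨
    weight x ∎
  go : ∀ {b} → Source _ forb k zero b →
    ∑ (λ x → 𝟙 (allows (forb zero) k x) * E (step k x)) ≡ Op (options b) E k
  go (free f≡ _)         = trans (sum-cong-≗ (unrestricted f≡)) total
  -- The barred color `y` is old, so its missing term is `E k`; adding it to both sides restores the
  -- unrestricted sum.
  go (barred y y<k f≡ _) = +-cancelʳ-≡ (E k) _ _ (begin
    ∑ (λ x → 𝟙 (allows (forb zero) k x) * E (step k x)) + E k
      ≡⟨ cong (∑ (λ x → 𝟙 (allows (forb zero) k x) * E (step k x)) +_) (∑-single (E k) y) ⟨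
    ∑ (λ x → 𝟙 (allows (forb zero) k x) * E (step k x)) + ∑ (λ x → 𝟙 ⌊ x ≟ᶠ y ⌋ * E k)
      ≡⟨ ∑-distrib-+ {m} _ _ ⟨
    ∑ (λ x → 𝟙 (allows (forb zero) k x) * E (step k x) + 𝟙 ⌊ x ≟ᶠ y ⌋ * E k)
      ≡⟨ sum-cong-≗ (restricted y y<k f≡) ⟩
    ∑ weight
      ≡⟨ total ⟩
    k * E k + E (suc k)
      ≡⟨ remove k (≤-trans (s≤s z≤n) y<k) (E k) (E (suc k)) ⟩
    pred k * E k + E (suc k) + E k ∎)
    where
    -- Since `y < k` makes `k` positive, `pred` takes off exactly one.
    remove : ∀ k → 0 < k → ∀ a b → k * a + b ≡ pred k * a + b + a
    remove (suc k) _ a b = trans (+-assoc a (k * a) b) (+-comm a (k * a + b))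

completions : ∀ {n} → (Fin n → Bool) → (ℕ → ℕ) → ℕ → ℕ
completions {zero}  b h = h
completions {suc n} b h = Op (options (b zero)) (completions (b ∘ suc) h)

-- Induction on the vertices: summing over the color of the first one gives its `Op`. The invariant
-- `k + n ≤ m` keeps a fresh color in stock for each remaining vertex.
count-completions : ∀ {m n} (G : Graph n) (forb : Fin n → Fin m → Bool) k (b : Fin n → Bool) K →
  (∀ i → Source G forb k i (b i)) → k + n ≤ m →
  count (λ v → extends? G forb k v ∧ (colorsUsed k (lookup v) ≡ᵇ K)) (allVecs m n)
    ≡ completions b (λ k → 𝟙 (k ≡ᵇ K)) k
count-completions {m} {zero} G forb k b K source k≤m = trans (count-∷ counted [] [])
  (trans (+-identityʳ _) (cong (λ l → 𝟙 (l ≡ᵇ K)) (colorsUsed-[] (subst (_≤ m) (+-identityʳ k) k≤m))))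
  where
  counted : Vec (Fin m) 0 → Bool
  counted v = extends? G forb k v ∧ (colorsUsed k (lookup v) ≡ᵇ K)
count-completions {m} {suc n} G forb k b K source k+n≤m = begin
  count (counted k G forb) (allVecs m (suc n))
    ≡⟨ count-allVecs (counted k G forb) ⟩
  ∑ (λ x → count (λ v → counted k G forb (x ∷ v)) (allVecs m n))
    ≡⟨ sum-cong-≗ branch ⟩
  ∑ (λ x → 𝟙 (allows (forb zero) k x) * completions (b ∘ suc) δ (step k x))
    ≡⟨ ∑-allows k<m (source zero) (completions (b ∘ suc) δ) ⟩
  completions b δ k ∎
  where
  open ≡-Reasoning
  k<m : k < m
  k<m = ≤-trans (≤-reflexive (+-comm 1 k)) (≤-trans (+-monoʳ-≤ k (s≤s z≤n)) k+n≤m)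
  δ : ℕ → ℕ
  δ k = 𝟙 (k ≡ᵇ K)
  counted : ∀ {n} → ℕ → Graph n → (Fin n → Fin m → Bool) → Vec (Fin m) n → Bool
  counted k G forb v = extends? G forb k v ∧ (colorsUsed k (lookup v) ≡ᵇ K)
  branch : ∀ x → count (λ v → counted k G forb (x ∷ v)) (allVecs m n) ≡
    𝟙 (allows (forb zero) k x) * completions (b ∘ suc) δ (step k x)
  branch x with allows (forb zero) k x in eq
  ... | false = count-∧ false (λ _ → false) (allVecs m n)
  ... | true  = begin
    count (λ v → extends? (tailᴳ G) (bar G forb x) (step k x) v ∧ (colorsUsed k (lookup (x ∷ v)) ≡ᵇ K))
      (allVecs m n)
      ≡⟨ count-cong (λ v → cong (λ l → extends? (tailᴳ G) (bar G forb x) (step k x) v ∧ (l ≡ᵇ K))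
           (colorsUsed-cons x≤k v)) (allVecs m n) ⟩
    count (counted (step k x) (tailᴳ G) (bar G forb x)) (allVecs m n)
      ≡⟨ count-completions (tailᴳ G) (bar G forb x) (step k x) (b ∘ suc) K
           (λ i → Source-tail x≤k (source (suc i)))
           (≤-trans (+-monoˡ-≤ n (step≤1+k x≤k)) (≤-trans (≤-reflexive (sym (+-suc k n))) k+n≤m)) ⟩
    completions (b ∘ suc) δ (step k x)
      ≡⟨ *-identityˡ _ ⟨
    1 * completions (b ∘ suc) δ (step k x) ∎
    where
    x≤k : toℕ x ≤ k
    x≤k = proj₁ (to (T-allows (forb zero)) (from T-≡ eq))

-- The definition of `S` and the recursive count

T-Proper : ∀ {n} (G : Graph n) c → T (Proper G c) ⇔ (∀ i j → adj G i j ≡ true → c i ≢ c j)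
T-Proper {n} G c = mk⇔
  (λ t i j a → separated a (to T-all (to T-all t i) j))
  (λ p → from T-all λ i → from T-all λ j → separate (p i j))
  where
  separated : ∀ {i j} → adj G i j ≡ true → T (not (adj G i j) ∨ not ⌊ c i ≟ᶠ c j ⌋) → c i ≢ c j
  separated {i} {j} a t c≡ rewrite a | c≡ | ≟-refl (c j) = t
  separate : ∀ {i j} → (adj G i j ≡ true → c i ≢ c j) → T (not (adj G i j) ∨ not ⌊ c i ≟ᶠ c j ⌋)
  separate {i} {j} p with adj G i j
  ... | false = _
  ... | true  = from T-not-≡ (≟-≢ (p refl))

-- Color 0 is written as `≤ 0` to match the field `canonical` of `Extends` with no color used yet.
T-Canonical : ∀ {n} (c : Fin n → Fin n) → T (Canonical c) ⇔
  (∀ i → toℕ (c i) ≤ 0 ⊎ ∃ λ j → toℕ j < toℕ i × suc (toℕ (c j)) ≡ toℕ (c i))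
T-Canonical {n} c = mk⇔
  (λ t i → ⇒ i (to T-∨ (to T-all t i)))
  (λ p → from T-all λ i → from T-∨ (⇐ i (p i)))
  where
  preceded : Fin n → Fin n → Bool
  preceded i j = ⌊ toℕ j <? toℕ i ⌋ ∧ (suc (toℕ (c j)) ≡ᵇ toℕ (c i))
  ⇒ : ∀ i → T (toℕ (c i) ≡ᵇ 0) ⊎ T (any (preceded i) (allFin n)) →
    toℕ (c i) ≤ 0 ⊎ ∃ λ j → toℕ j < toℕ i × suc (toℕ (c j)) ≡ toℕ (c i)
  ⇒ i (inj₁ t) = inj₁ (≤-reflexive (≡ᵇ⇒≡ _ _ t))
  ⇒ i (inj₂ t) = let j , u = to T-any t ; lt , eq = to T-∧ u in inj₂ (j , toWitness lt , ≡ᵇ⇒≡ _ _ eq)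
  ⇐ : ∀ i → toℕ (c i) ≤ 0 ⊎ (∃ λ j → toℕ j < toℕ i × suc (toℕ (c j)) ≡ toℕ (c i)) →
    T (toℕ (c i) ≡ᵇ 0) ⊎ T (any (preceded i) (allFin n))
  ⇐ i (inj₁ le) = inj₁ (≡⇒≡ᵇ _ _ (n≤0⇒n≡0 le))
  ⇐ i (inj₂ (j , lt , eq)) = inj₂ (from T-any (j , from T-∧ (fromWitness lt , ≡⇒≡ᵇ _ _ eq)))

-- With nothing colored before, the proper canonical colorings are just the extensions; `n` colors
-- for `n` vertices meet the invariant with equality.
S≡completions : ∀ {n} (G : Graph n) (b : Fin n → Bool) →
  (∀ i → Source {n} G (λ _ _ → false) 0 i (b i)) → ∀ K →
  S G K ≡ completions b (λ k → 𝟙 (k ≡ᵇ K)) 0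
S≡completions {n} G b source K = begin
  S G K
    ≡⟨ count-map _ lookup (allVecs n n) ⟩
  count (λ v → Proper G (lookup v) ∧ Canonical (lookup v) ∧ (numBlocks (lookup v) ≡ᵇ K)) (allVecs n n)
    ≡⟨ count-cong (λ v → trans (sym (∧-assoc (Proper G (lookup v)) _ _)) (cong (_∧ _) (same v)))
         (allVecs n n) ⟩
  count (λ v → extends? G none 0 v ∧ (colorsUsed 0 (lookup v) ≡ᵇ K)) (allVecs n n)
    ≡⟨ count-completions G none 0 b K source ≤-refl ⟩
  completions b (λ k → 𝟙 (k ≡ᵇ K)) 0 ∎
  where
  open ≡-Reasoning
  none : Fin n → Fin n → Bool
  none _ _ = false
  same : ∀ v → Proper G (lookup v) ∧ Canonical (lookup v) ≡ extends? G none 0 v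
  same v = T⇔→≡ (mk⇔
    (λ t → let p , q = to T-∧ t in from (T-extends? G none 0 v)
      (record { proper = to (T-Proper G _) p ; avoids = λ _ → refl ; canonical = to (T-Canonical _) q }))
    (λ t → let open Extends (to (T-extends? G none 0 v) t) in
      from T-∧ (from (T-Proper G _) proper , from (T-Canonical _) canonical)))

-- Graphs of maximum degree one

∑-mono : ∀ {n} (f g : Fin n → Bool) → (∀ i → T (f i) → T (g i)) → ∑ (𝟙 ∘ f) ≤ ∑ (𝟙 ∘ g)
∑-mono {zero}  f g f⇒g = z≤n
∑-mono {suc n} f g f⇒g = +-mono-≤ (𝟙-mono (f⇒g zero)) (∑-mono (f ∘ suc) (g ∘ suc) (f⇒g ∘ suc))
  where
  𝟙-mono : ∀ {a b} → (T a → T b) → 𝟙 a ≤ 𝟙 b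
  𝟙-mono {false} _ = z≤n
  𝟙-mono {true} {true}  _ = s≤s z≤n
  𝟙-mono {true} {false} i = ⊥-elim (i _)

∑-strict : ∀ {n} (f g : Fin n → Bool) → (∀ i → T (f i) → T (g i)) →
  ∀ i → T (g i) → ¬ T (f i) → ∑ (𝟙 ∘ f) < ∑ (𝟙 ∘ g)
∑-strict f g f⇒g zero    gi ¬fi with f zero | g zero
... | false | true = s≤s (∑-mono (f ∘ suc) (g ∘ suc) (f⇒g ∘ suc))
... | true  | true = ⊥-elim (¬fi _)
∑-strict f g f⇒g (suc i) gi ¬fi with f zero | g zero | f⇒g zero
... | false | false | _   = ∑-strict (f ∘ suc) (g ∘ suc) (f⇒g ∘ suc) i gi ¬fi
... | true  | true  | _   = s≤s (∑-strict (f ∘ suc) (g ∘ suc) (f⇒g ∘ suc) i gi ¬fi)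
... | false | true  | _   = m<n⇒m<1+n (∑-strict (f ∘ suc) (g ∘ suc) (f⇒g ∘ suc) i gi ¬fi)
... | true  | false | f⇒g₀ = ⊥-elim (f⇒g₀ _)

∑-inhabited : ∀ {n} (f : Fin n → Bool) i → T (f i) → 0 < ∑ (𝟙 ∘ f)
∑-inhabited {n} f i fi =
  subst (_< ∑ (𝟙 ∘ f)) (sum-replicate-zero n) (∑-strict (const false) f (λ _ ()) i fi id)

∑≤1⇒unique : ∀ {n} (f : Fin n → Bool) → ∑ (𝟙 ∘ f) ≤ 1 → ∀ i j → T (f i) → T (f j) → i ≡ j
∑≤1⇒unique f s≤1 zero    zero    fi fj = refl
∑≤1⇒unique f s≤1 zero    (suc j) fi fj with f zero
... | true = contradiction (∑-inhabited (f ∘ suc) j fj) (≤⇒≯ (s≤s⁻¹ s≤1))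
∑≤1⇒unique f s≤1 (suc i) zero    fi fj with f zero
... | true = contradiction (∑-inhabited (f ∘ suc) i fi) (≤⇒≯ (s≤s⁻¹ s≤1))
∑≤1⇒unique f s≤1 (suc i) (suc j) fi fj =
  cong suc (∑≤1⇒unique (f ∘ suc) (m+n≤o⇒n≤o (𝟙 (f zero)) s≤1) i j fi fj)

unique⇒∑≤1 : ∀ {n} (f : Fin n → Bool) → (∀ i j → T (f i) → T (f j) → i ≡ j) → ∑ (𝟙 ∘ f) ≤ 1
unique⇒∑≤1 {zero}  f uniq = z≤n
unique⇒∑≤1 {suc n} f uniq with f zero in eq
... | false = unique⇒∑≤1 (f ∘ suc) λ i j fi fj → sucᶠ-injective (uniq (suc i) (suc j) fi fj)
... | true  = s≤s (≤-reflexive (trans (sum-cong-≗ (λ i → cong 𝟙 (¬T (rest i)))) (sum-replicate-zero n)))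
  where
  rest : ∀ i → ¬ T (f (suc i))
  rest i fi with () ← uniq zero (suc i) (from T-≡ eq) fi
  ¬T : ∀ {b} → ¬ T b → b ≡ false
  ¬T {false} _ = refl
  ¬T {true}  t = ⊥-elim (t _)

-- Pigeonhole: if a value were missed, punching it out would inject `suc n` elements into `n`.
injective⇒permutation : ∀ {n} (f : Fin n → Fin n) → Injective _≡_ _≡_ f →
  Σ (Permutation′ n) λ π → ∀ i → π ⟨$⟩ʳ i ≡ f i
injective⇒permutation {suc n} f inj =
  permutation f (proj₁ ∘ preimage) (proj₂ ∘ preimage) (λ i → inj (proj₂ (preimage (f i)))) , λ _ → refl
  where
  preimage : ∀ y → ∃ λ x → f x ≡ y
  preimage y with any? (λ x → f x ≟ᶠ y)
  ... | yes found = found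
  ... | no missed = contradiction
    (injective⇒≤ {f = λ x → punchOut (≢y x)} λ {x} {x′} eq →
      inj (punchOut-injective (≢y x) (≢y x′) eq)) 1+n≰n
    where
    ≢y : ∀ x → y ≢ f x
    ≢y x eq = missed (x , sym eq)
injective⇒permutation {zero} f inj = permutation f f (λ ()) (λ ()) , λ ()

AtMostOneNeighbor : ∀ {n} → Graph n → Set
AtMostOneNeighbor G = ∀ i j k → adj G i j ≡ true → adj G i k ≡ true → j ≡ k

Isolated : ∀ {n} → Graph n → Fin n → Set
Isolated G i = ∀ j → adj G i j ≡ false

AtMostOneIsolated : ∀ {n} → Graph n → Set
AtMostOneIsolated G = ∀ i j → Isolated G i → Isolated G j → i ≡ j

deg≤1⇒AtMostOneNeighbor : ∀ {n} (G : Graph n) → (∀ v → deg G v ≤ 1) → AtMostOneNeighbor G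
deg≤1⇒AtMostOneNeighbor {n} G deg≤1 i j k a b =
  ∑≤1⇒unique (adj G i) (subst (_≤ 1) (count-tabulate (adj G i) id) (deg≤1 i)) j k (from T-≡ a) (from T-≡ b)

-- With `suc k` colors in use, a vertex with an earlier neighbor has `k` old choices and any other
-- `suc k`: these are `M` and `U` at `k`. As they commute, only the numbers of both kinds survive,
-- not the order of the vertices.
completions-V : ∀ {n} (b : Fin n → Bool) h k →
  completions b h (suc k) ≡ V (∑ (𝟙 ∘ b)) (∑ (𝟙 ∘ not ∘ b)) (h ∘ suc) k
completions-V {zero}  b h k = refl
completions-V {suc n} b h k with b zero
... | true  = trans (cong₂ (λ x y → k * x + y) (completions-V (b ∘ suc) h k)
    (completions-V (b ∘ suc) h (suc k)))
  (M-V (∑ (𝟙 ∘ b ∘ suc)) (∑ (𝟙 ∘ not ∘ b ∘ suc)) (h ∘ suc) k)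
... | false = trans (cong₂ (λ x y → suc k * x + y) (completions-V (b ∘ suc) h k)
    (completions-V (b ∘ suc) h (suc k)))
  (U-V (∑ (𝟙 ∘ b ∘ suc)) (∑ (𝟙 ∘ not ∘ b ∘ suc)) (h ∘ suc) k)

-- Mates, edges and isolated vertices

module Matching {n} (G : Graph n) (uniq : AtMostOneNeighbor G) where

  -- An isolated vertex is its own mate, which makes `mate` a total involution.
  mate : Fin n → Fin n
  mate i with any? (λ j → adj G i j ≟ᵇ true)
  ... | yes (j , _) = j
  ... | no _        = i

  mate-view : ∀ i → adj G i (mate i) ≡ true ⊎ (mate i ≡ i × Isolated G i)
  mate-view i with any? (λ j → adj G i j ≟ᵇ true)
  ... | yes (_ , a) = inj₁ a
  ... | no none     = inj₂ (refl , λ j → ¬-not (λ a → none (j , a)))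

  adj⇒≢ : ∀ {i j} → adj G i j ≡ true → i ≢ j
  adj⇒≢ {i} a refl = contradiction (trans (sym a) (irrefl G i)) λ ()

  adj⇒mate : ∀ {i j} → adj G i j ≡ true → mate i ≡ j
  adj⇒mate {i} {j} a with mate-view i
  ... | inj₁ b            = uniq i _ _ b a
  ... | inj₂ (_ , isolated) = contradiction (trans (sym a) (isolated j)) λ ()

  mate≢⇒adj : ∀ {i} → mate i ≢ i → adj G i (mate i) ≡ true
  mate≢⇒adj {i} m≢i with mate-view i
  ... | inj₁ a         = a
  ... | inj₂ (m≡i , _) = contradiction m≡i m≢i

  mate≡⇒Isolated : ∀ {i} → mate i ≡ i → Isolated G i
  mate≡⇒Isolated {i} m≡i with mate-view i
  ... | inj₁ a              = contradiction (sym m≡i) (adj⇒≢ a)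
  ... | inj₂ (_ , isolated) = isolated

  mate-involutive : ∀ i → mate (mate i) ≡ i
  mate-involutive i with mate-view i
  ... | inj₁ a         = adj⇒mate (trans (Defs.sym G (mate i) i) a)
  ... | inj₂ (m≡i , _) = trans (cong mate m≡i) m≡i

  upper lower single : Fin n → Bool
  upper i  = toℕ (mate i) <ᵇ toℕ i
  lower i  = toℕ i <ᵇ toℕ (mate i)
  single i = ⌊ mate i ≟ᶠ i ⌋

  -- An edge is counted at its upper end, the one of its two vertices that has an earlier neighbor.
  edges singles : ℕ
  edges   = ∑ (𝟙 ∘ upper)
  singles = ∑ (𝟙 ∘ single)

  -- The involution `mate` exchanges upper and lower ends, so the sum is merely permuted.
  ∑-lower : ∑ (𝟙 ∘ lower) ≡ edges
  ∑-lower = sym (trans (sum-permute (𝟙 ∘ upper) (permutation mate mate mate-involutive mate-involutive))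
    (sum-cong-≗ (λ i → cong (λ j → 𝟙 (toℕ j <ᵇ toℕ (mate i))) (mate-involutive i))))

  ∑-types : edges + edges + singles ≡ n
  ∑-types = begin
    edges + edges + singles                         ≡⟨ cong (λ e → edges + e + singles) ∑-lower ⟨
    edges + ∑ (𝟙 ∘ lower) + singles               ≡⟨ cong (_+ singles) (∑-distrib-+ (𝟙 ∘ upper) (𝟙 ∘ lower)) ⟨
    ∑ (λ i → 𝟙 (upper i) + 𝟙 (lower i)) + singles ≡⟨ ∑-distrib-+ _ (𝟙 ∘ single) ⟨
    ∑ (λ i → 𝟙 (upper i) + 𝟙 (lower i) + 𝟙 (single i)) ≡⟨ sum-cong-≗ one ⟩
    ∑ {n} (λ _ → 1)                                 ≡⟨ ∑-ones n ⟩
    n                                               ∎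
    where
    open ≡-Reasoning
    ∑-ones : ∀ n → ∑ {n} (λ _ → 1) ≡ n
    ∑-ones zero    = refl
    ∑-ones (suc n) = cong suc (∑-ones n)
    ≮⇒false : ∀ {a b} → ¬ a < b → (a <ᵇ b) ≡ false
    ≮⇒false a≮b = ¬-not (a≮b ∘ <ᵇ⇒< _ _ ∘ from T-≡)
    <⇒true : ∀ {a b} → a < b → (a <ᵇ b) ≡ true
    <⇒true = to T-≡ ∘ <⇒<ᵇ
    one : ∀ i → 𝟙 (upper i) + 𝟙 (lower i) + 𝟙 (single i) ≡ 1
    one i with <ᶠ-cmp i (mate i)
    ... | tri< lt neq ngt rewrite ≮⇒false ngt | <⇒true lt | ≟-≢ (neq ∘ sym) = refl
    ... | tri> nlt neq gt rewrite ≮⇒false nlt | <⇒true gt | ≟-≢ (neq ∘ sym) = refl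
    ... | tri≈ nlt eq ngt rewrite ≮⇒false nlt | ≮⇒false ngt | sym eq | ≟-refl i = refl

  source : ∀ i → Source {n} G (λ _ _ → false) 0 i (upper i)
  source i with upper i in eq
  ... | true  = joined (mate i) m<i (trans (Defs.sym G (mate i) i) (mate≢⇒adj (<⇒≢ m<i ∘ cong toℕ)))
    (λ _ → refl) (λ j a → sym (adj⇒mate (trans (Defs.sym G i j) a)))
    where
    m<i : toℕ (mate i) < toℕ i
    m<i = <ᵇ⇒< _ _ (from T-≡ eq)
  ... | false = free (λ _ → refl) λ j j<i → ¬-not λ a →
    contradiction (trans (sym (to T-≡ (upper-i a j<i))) eq) λ ()
    where
    upper-i : ∀ {j} → adj G j i ≡ true → toℕ j < toℕ i → T (upper i)
    upper-i {j} a j<i =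
      <⇒<ᵇ (subst (λ m → toℕ m < toℕ i) (sym (adj⇒mate (trans (Defs.sym G i j) a))) j<i)

  AtMostOneIsolated⇒singles≤1 : AtMostOneIsolated G → singles ≤ 1
  AtMostOneIsolated⇒singles≤1 one = unique⇒∑≤1 single λ i j si sj →
    one i j (mate≡⇒Isolated (toWitness si)) (mate≡⇒Isolated (toWitness sj))

  -- Numbers the edges by their lower ends, in increasing order, from 0 to `edges - 1`.
  rank : Fin n → ℕ
  rank u = ∑ (λ j → 𝟙 ((toℕ j <ᵇ toℕ u) ∧ lower j))

  rank-irrefl : ∀ u → ¬ T ((toℕ u <ᵇ toℕ u) ∧ lower u)
  rank-irrefl u t = <-irrefl refl (<ᵇ⇒< (toℕ u) (toℕ u) (proj₁ (to (T-∧ {toℕ u <ᵇ toℕ u}) t)))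

  rank-mono : ∀ {u w} → T (lower u) → toℕ u < toℕ w → rank u < rank w
  rank-mono {u} {w} lu u<w = ∑-strict _ _
    (λ j t → let a , b = to T-∧ t in from T-∧ (<⇒<ᵇ (<-trans (<ᵇ⇒< _ _ a) u<w) , b))
    u (from T-∧ (<⇒<ᵇ u<w , lu)) (rank-irrefl u)

  rank<edges : ∀ {u} → T (lower u) → rank u < edges
  rank<edges {u} lu = subst (rank u <_) ∑-lower (∑-strict _ lower (λ j t → proj₂ (to T-∧ t))
    u lu (rank-irrefl u))

  rank-injective : ∀ {u w} → T (lower u) → T (lower w) → rank u ≡ rank w → u ≡ w
  rank-injective {u} {w} lu lw eq with <ᶠ-cmp u w
  ... | tri< lt _ _ = contradiction eq (<⇒≢ (rank-mono lu lt))
  ... | tri≈ _ u≡w _ = u≡w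
  ... | tri> _ _ gt = contradiction (sym eq) (<⇒≢ (rank-mono lw gt))

  -- Place i r b sends i to the vertex 2r + b of the matching graph.
  data Place (i : Fin n) : ℕ → Bool → Set where
    lone  : mate i ≡ i → Place i edges false
    left  : T (lower i) → Place i (rank i) false
    right : T (lower (mate i)) → Place i (rank (mate i)) true

  place : ∀ i → ∃₂ (Place i)
  place i with <ᶠ-cmp i (mate i)
  ... | tri< lt _ _  = _ , _ , left (<⇒<ᵇ lt)
  ... | tri≈ _ i≡m _ = _ , _ , lone (sym i≡m)
  ... | tri> _ _ gt  =
    _ , _ , right (<⇒<ᵇ (subst (λ j → toℕ (mate i) < toℕ j) (sym (mate-involutive i)) gt))

  half : Fin n → ℕ
  half i = proj₁ (place i)

  label : Fin n → ℕ
  label i = 𝟙 (proj₁ (proj₂ (place i))) + half i * 2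

-- The isomorphism with the matching graph

label/2 : ∀ b r → (𝟙 b + r * 2) / 2 ≡ r
label/2 false r = m*n/n≡m r 2
label/2 true  r = trans (+-distrib-/-∣ʳ 1 (n∣m*n r {2})) (m*n/n≡m r 2)

𝟙-injective : ∀ {b c} → 𝟙 b ≡ 𝟙 c → b ≡ c
𝟙-injective {false} {false} _ = refl
𝟙-injective {true}  {true}  _ = refl

double : ∀ r → r + r ≡ r * 2
double = solve-∀

T-matchAdj : ∀ {n} {i j : Fin n} → T (matchAdj i j) ⇔ (toℕ i / 2 ≡ toℕ j / 2 × i ≢ j)
T-matchAdj {i = i} {j} = mk⇔
  (λ t → let a , b = to T-∧ t in toWitness a ,
    λ i≡j → contradiction (trans (sym (to T-≡ (from T-≟ i≡j))) (to T-not-≡ b)) λ ())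
  (λ (a , b) → from T-∧ (fromWitness a , from T-not-≡ (≟-≢ b)))

module _ {n} (G : Graph n) (uniq : AtMostOneNeighbor G) (one : Matching.singles G uniq ≤ 1) where
  open Matching G uniq

  private
    lone-unique : ∀ {i j} → mate i ≡ i → mate j ≡ j → i ≡ j
    lone-unique {i} {j} mi mj = ∑≤1⇒unique single one i j (fromWitness mi) (fromWitness mj)

    pair<n : ∀ {r} → r < edges → suc (r * 2) < n
    pair<n {r} r<e = begin
      suc r * 2           ≤⟨ *-monoˡ-≤ 2 r<e ⟩
      edges * 2           ≡⟨ double edges ⟨
      edges + edges       ≤⟨ m≤m+n _ singles ⟩
      edges + edges + singles ≡⟨ ∑-types ⟩
      n ∎
      where
      open ≤-Reasoning

    place<n : ∀ {i r b} → Place i r b → 𝟙 b + r * 2 < n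
    place<n (left l)  = <-trans (n<1+n _) (pair<n (rank<edges l))
    place<n (right l) = pair<n (rank<edges l)
    -- The lone vertex itself makes `singles` positive, which gives the strict inequality.
    place<n {i} (lone mi) = begin-strict
      edges * 2               ≡⟨ double edges ⟨
      edges + edges           ≡⟨ +-identityʳ _ ⟨
      edges + edges + 0       <⟨ +-monoʳ-< (edges + edges) (∑-inhabited single i (fromWitness mi)) ⟩
      edges + edges + singles ≡⟨ ∑-types ⟩
      n ∎
      where open ≤-Reasoning

    place-injective : ∀ {i j r b} → Place i r b → Place j r b → i ≡ j
    place-injective p q = go p q refl
      where
      go : ∀ {i j r r′ b} → Place i r b → Place j r′ b → r ≡ r′ → i ≡ j
      go (lone mi) (lone mj) _  = lone-unique mi mj
      go (lone mi) (left l)  eq = contradiction (sym eq) (<⇒≢ (rank<edges l))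
      go (left l)  (lone mj) eq = contradiction eq (<⇒≢ (rank<edges l))
      go (left l)  (left l′) eq = rank-injective l l′ eq
      go {i} {j} (right l) (right l′) eq =
        trans (sym (mate-involutive i)) (trans (cong mate (rank-injective l l′ eq)) (mate-involutive j))

    -- Equal halves at distinct vertices leave only the two ends of one edge: ranks of lower ends
    -- are distinct and below `edges`, and there is at most one lone vertex.
    place-adj : ∀ {i j r r′ b b′} → Place i r b → Place j r′ b′ → r ≡ r′ → i ≢ j → adj G i j ≡ true
    place-adj (lone mi) (lone mj)  _  i≢j = contradiction (lone-unique mi mj) i≢j
    place-adj (lone mi) (left l)   eq _   = contradiction (sym eq) (<⇒≢ (rank<edges l))
    place-adj (lone mi) (right l)  eq _   = contradiction (sym eq) (<⇒≢ (rank<edges l))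
    place-adj (left l)  (lone mj)  eq _   = contradiction eq (<⇒≢ (rank<edges l))
    place-adj (right l) (lone mj)  eq _   = contradiction eq (<⇒≢ (rank<edges l))
    place-adj (left l)  (left l′)  eq i≢j = contradiction (rank-injective l l′ eq) i≢j
    place-adj {i} {j} (right l) (right l′) eq i≢j = contradiction
      (trans (sym (mate-involutive i)) (trans (cong mate (rank-injective l l′ eq)) (mate-involutive j))) i≢j
    place-adj {i} {j} (left l) (right l′) eq i≢j with refl ← rank-injective l l′ eq =
      trans (Defs.sym G (mate j) j) (mate≢⇒adj i≢j)
    place-adj {i} {j} (right l) (left l′) eq i≢j with refl ← rank-injective l l′ eq =
      mate≢⇒adj (i≢j ∘ sym)

    place-mate : ∀ {i r r′ b b′} → Place i r b → Place (mate i) r′ b′ → mate i ≢ i → r ≡ r′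
    place-mate (lone mi) _ m≢i = contradiction mi m≢i
    place-mate {i} _ (lone mi) m≢i = contradiction (trans (sym mi) (mate-involutive i)) m≢i
    place-mate {i} (left l) (left l′) _ = contradiction (<ᵇ⇒< _ _ l)
      (<-asym (subst (λ j → toℕ (mate i) < toℕ j) (mate-involutive i) (<ᵇ⇒< _ _ l′)))
    place-mate {i} (left _)  (right _) _ = cong rank (sym (mate-involutive i))
    place-mate     (right _) (left _)  _ = refl
    place-mate {i} (right l) (right l′) _ = contradiction (<ᵇ⇒< _ _ l)
      (<-asym (subst (λ j → toℕ (mate (mate i)) < toℕ j) (mate-involutive (mate i)) (<ᵇ⇒< _ _ l′)))

  label<n : ∀ i → label i < n
  label<n i = place<n (proj₂ (proj₂ (place i)))

  embed : Fin n → Fin n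
  embed i = fromℕ< (label<n i)

  embed/2 : ∀ i → toℕ (embed i) / 2 ≡ half i
  embed/2 i = trans (cong (_/ 2) (toℕ-fromℕ< (label<n i))) (label/2 (proj₁ (proj₂ (place i))) (half i))

  embed-injective : Injective _≡_ _≡_ embed
  embed-injective {i} {j} eq with place i | place j | label-eq | half-eq
    where
    label-eq : label i ≡ label j
    label-eq = trans (sym (toℕ-fromℕ< (label<n i))) (trans (cong toℕ eq) (toℕ-fromℕ< (label<n j)))
    half-eq : half i ≡ half j
    half-eq = trans (sym (embed/2 i)) (trans (cong (λ k → toℕ k / 2) eq) (embed/2 j))
  ... | r , b , p | r′ , b′ , q | leq | refl
    -- Equal halves cancel from the labels, which leaves equal bits.
    with refl ← 𝟙-injective {b} {b′} (+-cancelʳ-≡ (r * 2) _ _ leq) =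
    place-injective p q

  -- Both adjacencies say that the vertices are distinct and share a half; `embed`, an injection of
  -- a finite set into itself, is a permutation.
  ≅matchingGraph : Isomorphic G (matchingGraph n)
  ≅matchingGraph with π , π≡ ← injective⇒permutation embed embed-injective = π , λ i j →
    trans (preserves i j) (sym (cong₂ matchAdj (π≡ i) (π≡ j)))
    where
    preserves : ∀ i j → adj G i j ≡ matchAdj (embed i) (embed j)
    preserves i j = T⇔→≡ (mk⇔
      (λ t → from T-matchAdj (trans (embed/2 i) (trans (halves (to T-≡ t)) (sym (embed/2 j))) ,
        adj⇒≢ (to T-≡ t) ∘ embed-injective))
      (λ t → let h , neq = to T-matchAdj t in from T-≡
        (place-adj (proj₂ (proj₂ (place i))) (proj₂ (proj₂ (place j)))
          (trans (sym (embed/2 i)) (trans h (embed/2 j))) (neq ∘ cong embed))))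
      where
      halves : adj G i j ≡ true → half i ≡ half j
      halves a with refl ← adj⇒mate a =
        place-mate (proj₂ (proj₂ (place i))) (proj₂ (proj₂ (place (mate i)))) (adj⇒≢ a ∘ sym)

-- Neighbors and isolated vertices in the matching graph

parity : ∀ a → a ≡ a / 2 * 2 ⊎ a ≡ suc (a / 2 * 2)
parity a with a % 2 | m≡m%n+[m/n]*n a 2 | m%n<n a 2
... | 0           | eq | _ = inj₁ eq
... | 1           | eq | _ = inj₂ eq
... | suc (suc _) | _  | s≤s (s≤s ())

-- A half is shared by one number of each parity, so `b` and `c` are both the partner of `a`.
same-half : ∀ {a b c} → a / 2 ≡ b / 2 → a / 2 ≡ c / 2 → a ≢ b → a ≢ c → b ≡ c
same-half {a} {b} {c} ab ac a≢b a≢c = go (parity a) (parity b) (parity c)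
  where
  go : a ≡ a / 2 * 2 ⊎ a ≡ suc (a / 2 * 2) → b ≡ b / 2 * 2 ⊎ b ≡ suc (b / 2 * 2) →
    c ≡ c / 2 * 2 ⊎ c ≡ suc (c / 2 * 2) → b ≡ c
  go _ (inj₁ eb) (inj₁ ec) = trans eb (trans (cong (_* 2) (trans (sym ab) ac)) (sym ec))
  go _ (inj₂ eb) (inj₂ ec) = trans eb (trans (cong (λ h → suc (h * 2)) (trans (sym ab) ac)) (sym ec))
  go (inj₁ ea) (inj₁ eb) _ = contradiction (trans ea (trans (cong (_* 2) ab) (sym eb))) a≢b
  go (inj₁ ea) _ (inj₁ ec) = contradiction (trans ea (trans (cong (_* 2) ac) (sym ec))) a≢c
  go (inj₂ ea) (inj₂ eb) _ = contradiction (trans ea (trans (cong (λ h → suc (h * 2)) ab) (sym eb))) a≢b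
  go (inj₂ ea) _ (inj₂ ec) = contradiction (trans ea (trans (cong (λ h → suc (h * 2)) ac) (sym ec))) a≢c

matchingGraph-AtMostOneNeighbor : ∀ n → AtMostOneNeighbor (matchingGraph n)
matchingGraph-AtMostOneNeighbor n i j k a b =
  let ab , i≢j = to (T-matchAdj {i = i} {j}) (from T-≡ a)
      ac , i≢k = to (T-matchAdj {i = i} {k}) (from T-≡ b) in
  toℕ-injective (same-half ab ac (i≢j ∘ toℕ-injective) (i≢k ∘ toℕ-injective))

-- The partner of an even vertex is the next one, which the bound keeps inside `Fin n`; that of an
-- odd vertex is the previous one.
matchingGraph-neighbor : ∀ {n} (i : Fin n) → suc (toℕ i) < n → ∃ λ j → matchAdj i j ≡ true
matchingGraph-neighbor {n} i 1+i<n = find (parity (toℕ i))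
  where
  neighbor : ∀ b (b<n : 𝟙 b + toℕ i / 2 * 2 < n) → toℕ i ≢ 𝟙 b + toℕ i / 2 * 2 →
    ∃ λ j → matchAdj i j ≡ true
  neighbor b b<n i≢b = fromℕ< b<n , to T-≡ (from T-matchAdj
    ( sym (trans (cong (_/ 2) (toℕ-fromℕ< b<n)) (label/2 b (toℕ i / 2)))
    , λ eq → i≢b (trans (cong toℕ eq) (toℕ-fromℕ< b<n)) ))
  find : toℕ i ≡ toℕ i / 2 * 2 ⊎ toℕ i ≡ suc (toℕ i / 2 * 2) → ∃ λ j → matchAdj i j ≡ true
  find (inj₁ even) = neighbor true (subst (λ a → suc a < n) even 1+i<n) (λ eq → 1+n≢n (trans (sym eq) even))
  find (inj₂ odd)  = neighbor false (<⇒≤ (subst (_< n) odd (toℕ<n i))) (λ eq → 1+n≢n (trans (sym odd) eq))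

matchingGraph-AtMostOneIsolated : ∀ n → AtMostOneIsolated (matchingGraph n)
matchingGraph-AtMostOneIsolated n i j isoᵢ isoⱼ with <ᶠ-cmp i j
... | tri≈ _ i≡j _ = i≡j
... | tri< lt _ _ = let k , a = matchingGraph-neighbor i (≤-<-trans lt (toℕ<n j)) in
  contradiction (trans (sym a) (isoᵢ k)) λ ()
... | tri> _ _ gt = let k , a = matchingGraph-neighbor j (≤-<-trans gt (toℕ<n i)) in
  contradiction (trans (sym a) (isoⱼ k)) λ ()

Isomorphic-AtMostOneIsolated : ∀ {n} {G H : Graph n} →
  Isomorphic G H → AtMostOneIsolated H → AtMostOneIsolated G
Isomorphic-AtMostOneIsolated {G = G} {H} (π , preserves) one i j isoᵢ isoⱼ =
  trans (sym (inverseˡ π)) (trans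
    (cong (π ⟨$⟩ˡ_) (one (π ⟨$⟩ʳ i) (π ⟨$⟩ʳ j) (moved isoᵢ) (moved isoⱼ)))
    (inverseˡ π))
  where
  moved : ∀ {i} → Isolated G i → Isolated H (π ⟨$⟩ʳ i)
  moved {i} iso k = trans (cong (adj H (π ⟨$⟩ʳ i)) (sym (inverseʳ π)))
    (trans (sym (preserves i (π ⟨$⟩ˡ k))) (iso (π ⟨$⟩ˡ k)))

∑-complement : ∀ {n} (b : Fin n → Bool) → ∑ (𝟙 ∘ b) + ∑ (𝟙 ∘ not ∘ b) ≡ n
∑-complement {zero}  b = refl
∑-complement {suc n} b with b zero
... | true  = cong suc (∑-complement (b ∘ suc))
... | false = trans (+-suc _ _) (cong suc (∑-complement (b ∘ suc)))

-- Comparison of the two graphs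

module Statistics {n} (G : Graph (suc n)) (uniq : AtMostOneNeighbor G) where
  open Matching G uniq public

  -- Vertex `zero` is left out: it has no earlier neighbor and produces the one used color from
  -- which `V` starts.
  rest : ℕ
  rest = ∑ (𝟙 ∘ not ∘ upper ∘ suc)

  edges+rest : edges + rest ≡ n
  edges+rest = ∑-complement (upper ∘ suc)

  -- With no color in use the first vertex can only open one, by computation, so `completions-V`
  -- applies with one color used. The weights `id` and `const 1` give `𝓣` and `𝓑`.
  weighted-S : ∀ w → sum (map (λ K → w K * S G K) (oneTo (suc n))) ≡ V edges rest (w ∘ suc) 0
  weighted-S w = trans
    (cong sum (map-cong (λ K → cong (w K *_) (trans (S≡completions G upper source K)
      (completions-V (upper ∘ suc) (λ k → 𝟙 (k ≡ᵇ K)) 0))) (oneTo (suc n))))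
    (subst (λ m → sum (map (λ K → w K * V edges rest (λ k → 𝟙 (suc k ≡ᵇ K)) 0) (oneTo (suc m)))
        ≡ V edges rest (w ∘ suc) 0)
      edges+rest (V-expand w edges rest))

  𝓣-blocks : 𝓣 G ≡ blocks edges rest
  𝓣-blocks = weighted-S id

  𝓑-partitions : 𝓑 G ≡ partitions edges rest
  𝓑-partitions = trans
    (cong sum (map-cong (λ K → sym (*-identityˡ (S G K))) (oneTo (suc n))))
    (weighted-S (const 1))

-- A smaller `p′` would leave at least two points outside its pairs, against `s′ ≤ 1`.
half-maximal : ∀ p s p′ s′ → p + p + s ≡ p′ + p′ + s′ → s′ ≤ 1 → p ≤ p′
half-maximal p s p′ s′ eq s′≤1 = ≮⇒≥ λ p′<p → <-irrefl (sym eq) (begin-strict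
  p′ + p′ + s′     ≤⟨ +-monoʳ-≤ (p′ + p′) s′≤1 ⟩
  p′ + p′ + 1      <⟨ ≤-reflexive (sucs p′) ⟩
  suc p′ + suc p′  ≤⟨ +-mono-≤ p′<p p′<p ⟩
  p + p            ≤⟨ m≤m+n (p + p) s ⟩
  p + p + s        ∎)
  where
  open ≤-Reasoning
  sucs : ∀ p → suc (p + p + 1) ≡ suc p + suc p
  sucs = solve-∀

mean-strict : ∀ {p q p′ q′} → p + q ≡ p′ + q′ → p < p′ →
  blocks p q * partitions p′ q′ < blocks p′ q′ * partitions p q
mean-strict {p} {q} {p′} {q′} eq p<p′
  with d , 1+p+d≡p′ ← m≤n⇒∃[o]m+o≡n p<p′
  with refl ← trans (cong suc (+-comm d p)) 1+p+d≡p′ =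
  subst (λ r → blocks p r * partitions (suc d + p) q′ < blocks (suc d + p) q′ * partitions p r)
    (+-cancelˡ-≡ p _ _ (trans (regroup p d q′) (sym eq))) (mean-strictly-increasing p q′ d)
  where
  regroup : ∀ p d q → p + (suc d + q) ≡ suc d + p + q
  regroup = solve-∀

theorem13 : (n : ℕ) (G : Graph n) → MaxDegreeOne G →
    (G 𝓐≤ matchingGraph n) × ((G 𝓐≡ matchingGraph n) ⇔ Isomorphic G (matchingGraph n))
theorem13 zero    G (_ , () , _)
theorem13 (suc n) G (deg≤1 , _) = 𝓐≤-matching , mk⇔ 𝓐≡⇒≅ (edges-≡⇒𝓐≡ ∘ ≅⇒edges-≡)
  where
  H = matchingGraph (suc n)
  uniqᴳ = deg≤1⇒AtMostOneNeighbor G deg≤1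
  module ℊ = Statistics G uniqᴳ
  module ℋ = Statistics H (matchingGraph-AtMostOneNeighbor (suc n))

  types≡ : ℊ.edges + ℊ.edges + ℊ.singles ≡ ℋ.edges + ℋ.edges + ℋ.singles
  types≡ = trans ℊ.∑-types (sym ℋ.∑-types)

  singlesᴴ≤1 : ℋ.singles ≤ 1
  singlesᴴ≤1 = ℋ.AtMostOneIsolated⇒singles≤1 (matchingGraph-AtMostOneIsolated (suc n))

  edges-≤ : ℊ.edges ≤ ℋ.edges
  edges-≤ = half-maximal ℊ.edges ℊ.singles ℋ.edges ℋ.singles types≡ singlesᴴ≤1

  rests≡ : ℊ.edges + ℊ.rest ≡ ℋ.edges + ℋ.rest
  rests≡ = trans ℊ.edges+rest (sym ℋ.edges+rest)

  edges-<⇒𝓐< : ℊ.edges < ℋ.edges → 𝓣 G * 𝓑 H < 𝓣 H * 𝓑 G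
  edges-<⇒𝓐< lt = subst₂ _<_ (sym (cong₂ _*_ ℊ.𝓣-blocks ℋ.𝓑-partitions))
    (sym (cong₂ _*_ ℋ.𝓣-blocks ℊ.𝓑-partitions)) (mean-strict {ℊ.edges} {ℊ.rest} rests≡ lt)

  edges-≡⇒𝓐≡ : ℊ.edges ≡ ℋ.edges → G 𝓐≡ H
  edges-≡⇒𝓐≡ eq = cong₂ _*_
    (trans ℊ.𝓣-blocks (trans (cong₂ blocks eq rest≡) (sym ℋ.𝓣-blocks)))
    (trans ℋ.𝓑-partitions (trans (sym (cong₂ partitions eq rest≡)) (sym ℊ.𝓑-partitions)))
    where
    rest≡ : ℊ.rest ≡ ℋ.rest
    rest≡ = +-cancelˡ-≡ ℊ.edges _ _ (trans rests≡ (cong (_+ ℋ.rest) (sym eq)))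

  𝓐≤-matching : G 𝓐≤ H
  𝓐≤-matching = [ <⇒≤ ∘ edges-<⇒𝓐< , ≤-reflexive ∘ edges-≡⇒𝓐≡ ]′ (m≤n⇒m<n∨m≡n edges-≤)

  -- Fewer edges would make the mean strictly smaller. Equal edge numbers leave equally many
  -- isolated vertices, so at most one in `G`, and this determines `G`.
  𝓐≡⇒≅ : G 𝓐≡ H → Isomorphic G H
  𝓐≡⇒≅ means≡ = [ (λ lt → contradiction means≡ (<⇒≢ (edges-<⇒𝓐< lt)))
                 , (λ eq → ≅matchingGraph G uniqᴳ (subst (_≤ 1) (sym (singles≡ eq)) singlesᴴ≤1))
                 ]′ (m≤n⇒m<n∨m≡n edges-≤)
    where
    singles≡ : ℊ.edges ≡ ℋ.edges → ℊ.singles ≡ ℋ.singles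
    singles≡ eq = +-cancelˡ-≡ (ℊ.edges + ℊ.edges) _ _
      (trans types≡ (cong (λ e → e + e + ℋ.singles) (sym eq)))

  -- An isomorphism transports the bound on isolated vertices to `G`, so both edge numbers are
  -- maximal.
  ≅⇒edges-≡ : Isomorphic G H → ℊ.edges ≡ ℋ.edges
  ≅⇒edges-≡ iso = ≤-antisym edges-≤ (half-maximal ℋ.edges ℋ.singles ℊ.edges ℊ.singles (sym types≡)
    (ℊ.AtMostOneIsolated⇒singles≤1
      (Isomorphic-AtMostOneIsolated {G = G} {H} iso (matchingGraph-AtMostOneIsolated (suc n)))))
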